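{- For every positive integer $k$, the graph $\overline{K_2+C_{2k+1}}$ is a spherical uniform disk graph but not a unit disk graph.
   Context: $K_t$ is the complete graph and $C_t$ the cycle on $t$ vertices; $G+H$ denotes the disjoint union of vertex-disjoint graphs, and $\overline{G}$ the complement of $G$. The intersection graph of a collection of objects has the objects as vertices, two distinct objects adjacent iff they intersect. A unit disk graph is the intersection graph of a finite collection of closed disks of a common radius in the Euclidean plane. On the unit sphere $\mathbb{S}^2\subset\mathbb{R}^3$ with spherical distance $d_{\mathbb{S}^2}(a,b)$ (the angle between vectors $a$ and $b$), the spherical disk of radius $r\in(0,\pi)$ centered at $v$ is $\{u\in\mathbb{S}^2: d_{\mathbb{S}^2}(u,v)\le r\}$. A spherical uniform disk graph is a graph which, for some $r\in(0,\pi)$, is the intersection graph of a finite collection of spherical disks all of radius $r$. -}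

module Defs where

open import Level using (0ℓ)
open import Algebra.Apartness.Bundles using (HeytingField)
open import Algebra.Bundles using (CommutativeRing; Semiring)
import Algebra.Definitions.RawSemiring as RawSemiringDefinitions
import Algebra.Properties.Ring as RingProperties
open import Data.Fin.Base using (Fin; toℕ; splitAt)
open import Data.Nat.Base as ℕ using (ℕ; NonZero)
open import Data.Nat.Properties using (_!≢0)
open import Data.Product.Base using (_×_; ∃-syntax; Σ-syntax; _,_; proj₁)
open import Data.Sum.Base using (_⊎_; inj₁; inj₂; swap)
open import Data.Sum.Relation.Binary.Pointwise as Sum using (Pointwise)
open import Data.Vec.Functional using (Vector)
open import Function.Base using (_∘_)
open import Function.Bundles using (_⇔_; Equivalence)
open import Relation.Binary.Core using (Rel)
open import Relation.Binary.Definitions using (Symmetric; Irreflexive)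
open import Relation.Binary.PropositionalEquality.Core using (_≡_; _≢_; ≢-sym)
open import Relation.Binary.Structures using (IsStrictPartialOrder)
open import Relation.Nullary.Negation.Core using (¬_)
open import Relation.Unary using (Pred; _≬_)

------------------------------------------------------------------------
-- Finite simple graphs

record Graph : Set₁ where
  field
    order  : ℕ
    _~_    : Rel (Fin order) 0ℓ
    sym    : Symmetric _~_
    irrefl : Irreflexive _≡_ _~_

K : ℕ → Graph
K t = record
  { order  = t
  ; _~_    = _≢_
  ; sym    = ≢-sym
  ; irrefl = λ i≡j i≢j → i≢j i≡j
  }

CyclicSuccessor : ∀ {t} → Rel (Fin t) 0ℓ
CyclicSuccessor {t} i j =
  ℕ.suc (toℕ i) ≡ toℕ j ⊎ (ℕ.suc (toℕ i) ≡ t × toℕ j ≡ 0)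

-- For t ≥ 3 the condition i ≢ j is automatic; it only removes the loop
-- that the formula would otherwise produce at t = 1.
C : ℕ → Graph
C t = record
  { order  = t
  ; _~_    = λ i j → i ≢ j × (CyclicSuccessor i j ⊎ CyclicSuccessor j i)
  ; sym    = λ (i≢j , s) → ≢-sym i≢j , swap s
  ; irrefl = λ i≡j (i≢j , _) → i≢j i≡j
  }

infixr 6 _⊕_

_⊕_ : Graph → Graph → Graph
G ⊕ H = record
  { order  = G.order ℕ.+ H.order
  ; _~_    = λ i j → Pointwise G._~_ H._~_ (splitAt G.order i) (splitAt G.order j)
  ; sym    = Sum.⊎-symmetric G.sym H.sym
  ; irrefl = λ { _≡_.refl → loopless _ }
  }
  where
  module G = Graph G
  module H = Graph H
  loopless : ∀ x → ¬ Pointwise G._~_ H._~_ x x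
  loopless (inj₁ i) p = G.irrefl _≡_.refl (Sum.drop-inj₁ p)
  loopless (inj₂ j) p = H.irrefl _≡_.refl (Sum.drop-inj₂ p)

∁ : Graph → Graph
∁ G = record
  { order  = G.order
  ; _~_    = λ i j → i ≢ j × ¬ (i G.~ j)
  ; sym    = λ (i≢j , i≁j) → ≢-sym i≢j , i≁j ∘ G.sym
  ; irrefl = λ i≡j (i≢j , _) → i≢j i≡j
  }
  where module G = Graph G

IsIntersectionGraph : {U : Set} (G : Graph) → (Fin (Graph.order G) → Pred U 0ℓ) → Set
IsIntersectionGraph G D = ∀ i j → i ≢ j → (i ~ j ⇔ D i ≬ D j)
  where open Graph G

------------------------------------------------------------------------
-- The real numbers: a Cauchy-complete Archimedean ordered field.
--
-- Classically these axioms determine ℝ up to a unique isomorphism.  The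
-- order is that of constructive analysis (no trichotomy; instead the
-- apartness, and hence _<_, is cotransitive and tight), so that the
-- Cauchy reals over ℚ are a model without excluded middle.

record RealNumbers : Set₁ where
  field
    heytingField : HeytingField 0ℓ 0ℓ 0ℓ

  open HeytingField heytingField public

  commutativeRing : CommutativeRing 0ℓ 0ℓ
  commutativeRing = record { isCommutativeRing = isCommutativeRing }

  open CommutativeRing commutativeRing public
    using (ring; semiring)

  open RawSemiringDefinitions (Semiring.rawSemiring semiring) public
    using (_^_; sum) renaming (_×_ to _·_)

  fromℕ : ℕ → Carrier
  fromℕ n = n · 1#

  infix 4 _<_ _≤_

  field
    _<_                  : Rel Carrier 0ℓ
    isStrictPartialOrder : IsStrictPartialOrder _≈_ _<_
    #⇔<⊎>                : ∀ x y → x # y ⇔ (x < y ⊎ y < x)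
    +-monoˡ-<            : ∀ {x y} z → x < y → x + z < y + z
    *-positive           : ∀ {x y} → 0# < x → 0# < y → 0# < x * y
    archimedean          : ∀ x → ∃[ n ] x < fromℕ n

  _≤_ : Rel Carrier 0ℓ
  x ≤ y = ¬ (y < x)

  -- Since m and n may be exchanged, this bounds ∣ s m - s n ∣ by ε.
  IsCauchy : (ℕ → Carrier) → Set
  IsCauchy s = ∀ ε → 0# < ε →
    ∃[ N ] ∀ m n → N ℕ.≤ m → N ℕ.≤ n → s m < s n + ε

  infix 4 _⟶_

  _⟶_ : (ℕ → Carrier) → Carrier → Set
  s ⟶ l = ∀ ε → 0# < ε →
    ∃[ N ] ∀ n → N ℕ.≤ n → s n < l + ε × l < s n + ε

  field
    complete : ∀ s → IsCauchy s → ∃[ l ] s ⟶ l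

  open IsStrictPartialOrder isStrictPartialOrder
    using (<-respˡ-≈; <-respʳ-≈)
    renaming (trans to <-trans)
  open RingProperties ring using (-0#≈0#; -‿distribˡ-*; -‿involutive)

  private
    x-0≈x : ∀ x → x - 0# ≈ x
    x-0≈x x = trans (+-congˡ -0#≈0#) (+-identityʳ x)

    1#0 : 1# # 0#
    1#0 = invertible⇒#
      (1# , trans (*-identityˡ _) (x-0≈x 1#) , trans (*-identityʳ _) (x-0≈x 1#))

    [-1]²≈1 : - 1# * - 1# ≈ 1#
    [-1]²≈1 = trans (sym (-‿distribˡ-* 1# (- 1#)))
                    (trans (-‿cong (*-identityˡ (- 1#))) (-‿involutive 1#))

  0<1 : 0# < 1#
  0<1 with Equivalence.to (#⇔<⊎> 1# 0#) 1#0
  ... | inj₂ 0<1 = 0<1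
  ... | inj₁ 1<0 = <-respʳ-≈ [-1]²≈1 (*-positive 0<-1 0<-1)
    where
    0<-1 : 0# < - 1#
    0<-1 = <-respˡ-≈ (-‿inverseʳ 1#) (<-respʳ-≈ (+-identityˡ (- 1#)) (+-monoˡ-< (- 1#) 1<0))

  0<fromℕ-suc : ∀ n → 0# < fromℕ (ℕ.suc n)
  0<fromℕ-suc ℕ.zero    = <-respʳ-≈ (sym (+-identityʳ 1#)) 0<1
  0<fromℕ-suc (ℕ.suc n) = <-trans (0<fromℕ-suc n)
    (<-respˡ-≈ (+-identityˡ _) (+-monoˡ-< (fromℕ (ℕ.suc n)) 0<1))

  fromℕ-invertible : ∀ n .{{_ : NonZero n}} → ∃[ y ] fromℕ n * y ≈ 1#
  fromℕ-invertible n@(ℕ.suc m) =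
    let y , _ , ny≈1 = #⇒invertible (Equivalence.from (#⇔<⊎> (fromℕ n) 0#) (inj₂ (0<fromℕ-suc m)))
    in  y , trans (*-congʳ (sym (x-0≈x (fromℕ n)))) ny≈1

  recip : ∀ n .{{_ : NonZero n}} → Carrier
  recip n = proj₁ (fromℕ-invertible n)

------------------------------------------------------------------------
-- Cosine, π and angles

module _ (ℝ : RealNumbers) where

  open RealNumbers ℝ

  cosTerm : Carrier → ℕ → Carrier
  cosTerm x i = (- 1#) ^ i * x ^ (2 ℕ.* i) * recip ((2 ℕ.* i) ℕ.!) {{(2 ℕ.* i) !≢0}}

  -- c = cos x, i.e. the cosine series at x converges to c.
  IsCos : Carrier → Carrier → Set
  IsCos x c = (λ n → sum {n} (cosTerm x ∘ toℕ)) ⟶ c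

  -- π is twice the least positive zero of the cosine.
  IsPi : Carrier → Set
  IsPi p = ∃[ h ]
    p ≈ h + h ×
    0# < h × IsCos h 0# × (∀ x → 0# < x → IsCos x 0# → h ≤ x)

  dot : ∀ {n} → Vector Carrier n → Vector Carrier n → Carrier
  dot u v = sum (λ i → u i * v i)

  𝕊² : Set
  𝕊² = ∃[ v ] dot {3} v v ≈ 1#

  -- The spherical distance is the angle between unit vectors: the
  -- θ ∈ [0, π] with cos θ = a · b, which is unique as cos is injective there.
  IsSphericalDistance : (π : Carrier) → 𝕊² → 𝕊² → Carrier → Set
  IsSphericalDistance π (a , _) (b , _) θ = 0# ≤ θ × θ ≤ π × IsCos θ (dot a b)

------------------------------------------------------------------------
-- Disks and disk graphs

  -- For r > 0, comparing squares avoids the square root in the Euclidean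
  -- distance.
  closedDisk : Carrier → Vector Carrier 2 → Pred (Vector Carrier 2) 0ℓ
  closedDisk r v u = dot u-v u-v ≤ r * r
    where
    u-v : Vector Carrier 2
    u-v i = u i - v i

  sphericalDisk : (π r : Carrier) → 𝕊² → Pred 𝕊² 0ℓ
  sphericalDisk π r v u = ∃[ θ ] IsSphericalDistance π u v θ × θ ≤ r

  IsUnitDiskGraph : Graph → Set
  IsUnitDiskGraph G =
    ∃[ r ] 0# < r ×
    Σ[ centre ∈ (Fin (Graph.order G) → Vector Carrier 2) ]
      IsIntersectionGraph G (λ i → closedDisk r (centre i))

  IsSphericalUniformDiskGraph : Graph → Set
  IsSphericalUniformDiskGraph G =
    ∃[ π ] IsPi π ×
    ∃[ r ] 0# < r × r < π ×
    Σ[ centre ∈ (Fin (Graph.order G) → 𝕊²) ]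
      IsIntersectionGraph G (λ i → sphericalDisk π r (centre i))

{-# OPTIONS --safe #-}
module Submission where

-- On the sphere, let a and b be the poles and put the vertex i of the cycle of
-- length n = 2k + 1 at (-1)ⁱ e (tᵢ) on the equator, where tᵢ = (2i - n) / n and e is the
-- rational parametrisation of the circle.  Consecutive vertices are then nearly
-- antipodal, and with cos r = 2 / n exactly the pairs required to be non-adjacent
-- have an angle exceeding 2r: two disks of radius r meet iff 1 + v ∙ w ≥ 2 (cos r)².
-- Neither sine nor addition formulas are needed: as a function of x² ∈ [0 , 4],
-- 1 - cos x is an alternating series with slope between 1/6 and 1/2, which yields
-- arc cosines, π, and the monotonicity of the cosine.
--
-- In the plane, let ∣ab∣ > 2r.  Two points within 2r of both a and b that are more
-- than 2r apart lie on opposite sides of the line ab, so consecutive vertices of the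
-- cycle would alternate between the two sides, which an odd cycle cannot do.

open import Defs
open import Algebra.Bundles using (CommutativeRing)
import Algebra.Properties.AbelianGroup
import Algebra.Properties.Ring
import Algebra.Properties.Semiring.Exp
import Algebra.Properties.Semiring.Mult
import Algebra.Properties.Semiring.Sum
import Algebra.Solver.Ring
open import Algebra.Solver.Ring.AlmostCommutativeRing
  using (AlmostCommutativeRing; fromCommutativeRing; _-Raw-AlmostCommutative⟶_; Induced-equivalence)
open import Data.Empty using (⊥; ⊥-elim)
open import Data.Fin.Base as Fin using (Fin; toℕ)
open import Data.Fin.Patterns using (0F; 1F; 2F)
import Data.Fin.Properties as Fin
open import Data.Integer.Base as ℤ using (ℤ; -[1+_])
import Data.Integer.Properties as ℤ
open import Data.Maybe.Base as Maybe using (Maybe)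
open import Data.Nat.Base as ℕ using (ℕ; zero; suc)
import Data.Nat.Properties as ℕ
open import Data.Nat.Tactic.RingSolver using (solve-∀)
open import Data.Product.Base using (_×_; ∃-syntax; _,_; proj₁; proj₂)
open import Data.Sum.Base as Sum using (_⊎_; inj₁; inj₂; [_,_]′)
import Data.Sum.Relation.Binary.Pointwise as Pointwise
open import Data.Vec.Functional using (Vector)
open import Function.Base using (_∘_)
open import Function.Bundles using (Equivalence; mk⇔)
open import Relation.Binary.Definitions using (WeaklyDecidable; tri<; tri≈; tri>)
open import Relation.Binary.PropositionalEquality.Core as ≡ using (_≡_; _≢_)
import Relation.Binary.Reasoning.Base.Triple
import Relation.Binary.Reasoning.Setoid
open import Relation.Binary.Structures using (IsPreorder; IsStrictPartialOrder)
open import Relation.Nullary.Decidable.Core using (dec⇒maybe)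
open import Relation.Nullary.Negation.Core using (¬_)
open import Relation.Unary using (_≬_)

-- Put P = n² + (2i - n)², which lies between n² and 2 n². For two centres v, w whose indices differ
-- by an odd d, 1 + v ∙ w = 8 n² d² / (P P′). The lower bound puts d = 1 strictly below 8 / n²,
-- since P and P′ cannot both equal n²; the upper bound puts d ≥ 2 at or above 8 / n². So 2 (cos r)²
-- = 8 / n² separates the two cases, and this is the origin of cos r = 2 / n. At even differences
-- only the first and the last index are far apart: as n is odd, index n would carry -e (1) = e
-- (-1), the point of index 0, so the list closes up to a cycle.
--
-- The order has no trichotomy and `_≤_` is a negated `_<_`. Whatever has to exist must be computed
-- with a rate of convergence, so arc cosines come from an explicit iteration, while weak
-- inequalities may be proved by refutation. In the plane the alternation of sides is available only
-- under a double negation, which suffices because the goal there is a contradiction.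

module Proof (ℝ : RealNumbers) where

  open RealNumbers ℝ
  open CommutativeRing commutativeRing using (+-abelianGroup)
  open IsStrictPartialOrder isStrictPartialOrder
    using (<-resp-≈; <-respˡ-≈; <-respʳ-≈)
    renaming (trans to <-trans; irrefl to <-irrefl; asym to <-asym)
  open Algebra.Properties.Semiring.Exp semiring using (^-assocʳ; ^-congˡ; ^-homo-*)
  open Algebra.Properties.Semiring.Sum semiring using (sum-cong-≋; ∑-distrib-+; *-distribˡ-sum)
  open Algebra.Properties.Semiring.Mult semiring using (×-homo-+; ×1-homo-*)
  open Algebra.Properties.AbelianGroup +-abelianGroup using (⁻¹-∙-comm)
  open Algebra.Properties.Ring ring using (-0#≈0#; -‿distribˡ-*; -‿involutive)

  -- Integer coefficients for the ring solver

  fromℤ : ℤ → Carrier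
  fromℤ (ℤ.+ n)  = fromℕ n
  fromℤ -[1+ n ] = - fromℕ (suc n)

  fromℕ-+ : ∀ m n → fromℕ (m ℕ.+ n) ≈ fromℕ m + fromℕ n
  fromℕ-+ = ×-homo-+ 1#

  module _ where
    open Relation.Binary.Reasoning.Setoid setoid

    fromℤ-⊖ : ∀ m n → fromℤ (m ℤ.⊖ n) ≈ fromℕ m - fromℕ n
    fromℤ-⊖ m       zero    = sym (trans (+-congˡ -0#≈0#) (+-identityʳ _))
    fromℤ-⊖ zero    (suc n) = sym (+-identityˡ _)
    fromℤ-⊖ (suc m) (suc n) = begin
      fromℤ (suc m ℤ.⊖ suc n)               ≡⟨ ≡.cong fromℤ (ℤ.[1+m]⊖[1+n]≡m⊖n m n) ⟩
      fromℤ (m ℤ.⊖ n)                       ≈⟨ fromℤ-⊖ m n ⟩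
      fromℕ m - fromℕ n                     ≈⟨ +-congˡ (+-identityˡ _) ⟨
      fromℕ m + (0# - fromℕ n)              ≈⟨ +-congˡ (+-congʳ (-‿inverseʳ 1#)) ⟨
      fromℕ m + (1# - 1# - fromℕ n)         ≈⟨ +-congˡ (+-assoc _ _ _) ⟩
      fromℕ m + (1# + (- 1# - fromℕ n))     ≈⟨ +-congˡ (+-congˡ (⁻¹-∙-comm 1# (fromℕ n))) ⟩
      fromℕ m + (1# - (1# + fromℕ n))       ≈⟨ +-assoc _ _ _ ⟨
      fromℕ m + 1# - (1# + fromℕ n)         ≈⟨ +-congʳ (+-comm _ _) ⟩
      fromℕ (suc m) - fromℕ (suc n)         ∎

    fromℤ-+ : ∀ i j → fromℤ (i ℤ.+ j) ≈ fromℤ i + fromℤ j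
    fromℤ-+ (ℤ.+ m)  (ℤ.+ n)  = fromℕ-+ m n
    fromℤ-+ (ℤ.+ m)  -[1+ n ] = fromℤ-⊖ m (suc n)
    fromℤ-+ -[1+ m ] (ℤ.+ n)  = trans (fromℤ-⊖ n (suc m)) (+-comm _ _)
    fromℤ-+ -[1+ m ] -[1+ n ] = begin
      - fromℕ (suc (suc (m ℕ.+ n)))         ≡⟨ ≡.cong (λ l → - fromℕ (suc l)) (ℕ.+-suc m n) ⟨
      - fromℕ (suc m ℕ.+ suc n)             ≈⟨ -‿cong (fromℕ-+ (suc m) (suc n)) ⟩
      - (fromℕ (suc m) + fromℕ (suc n))     ≈⟨ ⁻¹-∙-comm _ _ ⟨
      - fromℕ (suc m) - fromℕ (suc n)       ∎

    fromℤ-neg : ∀ i → fromℤ (ℤ.- i) ≈ - fromℤ i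
    fromℤ-neg (ℤ.+ zero)  = sym -0#≈0#
    fromℤ-neg (ℤ.+ suc n) = refl
    fromℤ-neg -[1+ n ]    = sym (-‿involutive _)

    fromℤ-+* : ∀ m i → fromℤ (ℤ.+ m ℤ.* i) ≈ fromℕ m * fromℤ i
    fromℤ-+* zero    i = sym (zeroˡ _)
    fromℤ-+* (suc m) i = begin
      fromℤ (ℤ.+ suc m ℤ.* i)         ≡⟨ ≡.cong fromℤ (ℤ.suc-* (ℤ.+ m) i) ⟩
      fromℤ (i ℤ.+ ℤ.+ m ℤ.* i)       ≈⟨ fromℤ-+ i _ ⟩
      fromℤ i + fromℤ (ℤ.+ m ℤ.* i)   ≈⟨ +-cong (sym (*-identityˡ _)) (fromℤ-+* m i) ⟩
      1# * fromℤ i + fromℕ m * fromℤ i ≈⟨ distribʳ _ _ _ ⟨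
      fromℕ (suc m) * fromℤ i         ∎

    fromℤ-* : ∀ i j → fromℤ (i ℤ.* j) ≈ fromℤ i * fromℤ j
    fromℤ-* (ℤ.+ m)  j = fromℤ-+* m j
    fromℤ-* -[1+ m ] j = begin
      fromℤ (-[1+ m ] ℤ.* j)          ≡⟨ ≡.cong fromℤ (ℤ.neg-distribˡ-* (ℤ.+ suc m) j) ⟨
      fromℤ (ℤ.- (ℤ.+ suc m ℤ.* j))   ≈⟨ fromℤ-neg (ℤ.+ suc m ℤ.* j) ⟩
      - fromℤ (ℤ.+ suc m ℤ.* j)       ≈⟨ -‿cong (fromℤ-+* (suc m) j) ⟩
      - (fromℕ (suc m) * fromℤ j)     ≈⟨ -‿distribˡ-* _ _ ⟩
      - fromℕ (suc m) * fromℤ j       ∎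

  almostCommutativeRing : AlmostCommutativeRing _ _
  almostCommutativeRing = fromCommutativeRing commutativeRing

  -- The coefficient 1 is interpreted as 1#, not as fromℕ 1 = 1# + 0#.
  coefficient : ℤ → Carrier
  coefficient (ℤ.+ 1) = 1#
  coefficient i       = fromℤ i

  coefficient≈fromℤ : ∀ i → coefficient i ≈ fromℤ i
  coefficient≈fromℤ (ℤ.+ 0)           = refl
  coefficient≈fromℤ (ℤ.+ 1)           = sym (+-identityʳ 1#)
  coefficient≈fromℤ (ℤ.+ suc (suc n)) = refl
  coefficient≈fromℤ -[1+ n ]          = refl

  coefficient-morphism : ℤ.+-*-rawRing -Raw-AlmostCommutative⟶ almostCommutativeRing
  coefficient-morphism = record
    { ⟦_⟧    = coefficient
    ; +-homo = λ i j → trans (coefficient≈fromℤ (i ℤ.+ j))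
        (trans (fromℤ-+ i j) (sym (+-cong (coefficient≈fromℤ i) (coefficient≈fromℤ j))))
    ; *-homo = λ i j → trans (coefficient≈fromℤ (i ℤ.* j))
        (trans (fromℤ-* i j) (sym (*-cong (coefficient≈fromℤ i) (coefficient≈fromℤ j))))
    ; -‿homo = λ i → trans (coefficient≈fromℤ (ℤ.- i))
        (trans (fromℤ-neg i) (sym (-‿cong (coefficient≈fromℤ i))))
    ; 0-homo = refl
    ; 1-homo = refl
    }

  coefficient-≟ : WeaklyDecidable (Induced-equivalence coefficient-morphism)
  coefficient-≟ i j = Maybe.map (λ i≡j → reflexive (≡.cong coefficient i≡j)) (dec⇒maybe (i ℤ.≟ j))

  module Solver = Algebra.Solver.Ring ℤ.+-*-rawRing almostCommutativeRing coefficient-morphism coefficient-≟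

  open Solver using (Polynomial; solve; con; _:+_; _:*_; _:-_; :-_; _:=_)

  infix 9 ♯_

  ♯_ : ∀ {n} → ℕ → Polynomial n
  ♯ m = con (ℤ.+ m)

  -- Arithmetic of the order

  private variable
    x y z x′ y′ : Carrier

  -- The substitute for trichotomy. Apartness is cotransitive, and a comparison that comes out in
  -- the wrong direction composes with x < y to yield the other alternative.
  <-cotrans : x < y → ∀ z → x < z ⊎ z < y
  <-cotrans {x} {y} x<y z with #-cotrans (Equivalence.from (#⇔<⊎> x y) (inj₁ x<y)) z
  ... | inj₁ x#z with Equivalence.to (#⇔<⊎> x z) x#z
  ...   | inj₁ x<z = inj₁ x<z
  ...   | inj₂ z<x = inj₂ (<-trans z<x x<y)
  <-cotrans {x} {y} x<y z | inj₂ z#y with Equivalence.to (#⇔<⊎> z y) z#y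
  ...   | inj₁ z<y = inj₂ z<y
  ...   | inj₂ y<z = inj₁ (<-trans x<y y<z)

  <⇒≤ : x < y → x ≤ y
  <⇒≤ = <-asym

  ≤-reflexive : x ≈ y → x ≤ y
  ≤-reflexive x≈y = <-irrefl (sym x≈y)

  ≤-refl : x ≤ x
  ≤-refl = ≤-reflexive refl

  ≤-trans : x ≤ y → y ≤ z → x ≤ z
  ≤-trans {y = y} x≤y y≤z z<x = [ y≤z , x≤y ]′ (<-cotrans z<x y)

  <-≤-trans : x < y → y ≤ z → x < z
  <-≤-trans {z = z} x<y y≤z = [ (λ x<z → x<z) , ⊥-elim ∘ y≤z ]′ (<-cotrans x<y z)

  ≤-<-trans : x ≤ y → y < z → x < z
  ≤-<-trans {x} x≤y y<z = [ ⊥-elim ∘ x≤y , (λ x<z → x<z) ]′ (<-cotrans y<z x)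

  -- Tightness of the apartness: two refuted strict inequalities make an equality.
  ≤-antisym : x ≤ y → y ≤ x → x ≈ y
  ≤-antisym x≤y y≤x = proj₁ (tight _ _) ([ y≤x , x≤y ]′ ∘ Equivalence.to (#⇔<⊎> _ _))

  ≤-isPreorder : IsPreorder _≈_ _≤_
  ≤-isPreorder = record { isEquivalence = isEquivalence ; reflexive = ≤-reflexive ; trans = ≤-trans }

  module ≤-Reasoning = Relation.Binary.Reasoning.Base.Triple
    ≤-isPreorder <-asym <-trans <-resp-≈ <⇒≤ <-≤-trans ≤-<-trans

  ≤-resp-≈ : x ≈ x′ → y ≈ y′ → x ≤ y → x′ ≤ y′
  ≤-resp-≈ x≈x′ y≈y′ x≤y y′<x′ = x≤y (<-respˡ-≈ (sym y≈y′) (<-respʳ-≈ (sym x≈x′) y′<x′))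

  <-resp₂-≈ : x ≈ x′ → y ≈ y′ → x < y → x′ < y′
  <-resp₂-≈ x≈x′ y≈y′ x<y = <-respˡ-≈ x≈x′ (<-respʳ-≈ y≈y′ x<y)

  <⇒0<- : x < y → 0# < y - x
  <⇒0<- {x} x<y = <-respˡ-≈ (-‿inverseʳ x) (+-monoˡ-< (- x) x<y)

  0<-⇒< : 0# < y - x → x < y
  0<-⇒< {y} {x} 0<y-x = <-resp₂-≈ (+-identityˡ x)
    (solve 2 (λ x y → y :- x :+ x := y) refl x y) (+-monoˡ-< x 0<y-x)

  ≤⇒0≤- : x ≤ y → 0# ≤ y - x
  ≤⇒0≤- {x} {y} x≤y y-x<0 = x≤y (0<-⇒< (<-respʳ-≈
    (solve 2 (λ x y → ♯ 0 :- (y :- x) := x :- y) refl x y) (<⇒0<- y-x<0)))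

  0≤-⇒≤ : 0# ≤ y - x → x ≤ y
  0≤-⇒≤ {y} {x} 0≤y-x y<x = 0≤y-x (0<-⇒< (<-respʳ-≈
    (solve 2 (λ x y → x :- y := ♯ 0 :- (y :- x)) refl x y) (<⇒0<- y<x)))

  -- The form in which polynomial inequalities are proved from here on: a visibly nonnegative d, and
  -- an identity for the solver.
  ≤-by : ∀ d → 0# ≤ d → d ≈ y - x → x ≤ y
  ≤-by _ 0≤d d≈y-x = 0≤-⇒≤ (≤-resp-≈ refl d≈y-x 0≤d)

  <-by : ∀ d → 0# < d → d ≈ y - x → x < y
  <-by _ 0<d d≈y-x = 0<-⇒< (<-respʳ-≈ d≈y-x 0<d)

  +-mono-≤ : x ≤ y → x′ ≤ y′ → x + x′ ≤ y + y′
  +-mono-≤ {x} {y} {x′} {y′} x≤y x′≤y′ = ≤-trans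
    (≤-by (y - x) (≤⇒0≤- x≤y) (solve 3 (λ x y x′ → y :- x := y :+ x′ :- (x :+ x′)) refl x y x′))
    (≤-by (y′ - x′) (≤⇒0≤- x′≤y′) (solve 3 (λ y x′ y′ → y′ :- x′ := y :+ y′ :- (y :+ x′)) refl y x′ y′))

  +-mono-<-≤ : x < y → x′ ≤ y′ → x + x′ < y + y′
  +-mono-<-≤ {x} {y} {x′} {y′} x<y x′≤y′ = <-≤-trans (+-monoˡ-< x′ x<y) (+-mono-≤ ≤-refl x′≤y′)

  +-mono-≤-< : x ≤ y → x′ < y′ → x + x′ < y + y′
  +-mono-≤-< x≤y x′<y′ = <-resp₂-≈ (+-comm _ _) (+-comm _ _) (+-mono-<-≤ x′<y′ x≤y)

  0≤+ : 0# ≤ x → 0# ≤ y → 0# ≤ x + y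
  0≤+ 0≤x 0≤y = ≤-resp-≈ (+-identityˡ 0#) refl (+-mono-≤ 0≤x 0≤y)

  0<+ : 0# < x → 0# ≤ y → 0# < x + y
  0<+ 0<x 0≤y = <-respˡ-≈ (+-identityˡ 0#) (+-mono-<-≤ 0<x 0≤y)

  -- A factor of an invertible element is invertible.
  sign-of-factor : x * y # 0# → y < 0# ⊎ 0# < y
  sign-of-factor {x} {y} xy#0 = Equivalence.to (#⇔<⊎> y 0#) (invertible⇒# (u * x , uxy≈1 , trans (*-comm _ _) uxy≈1))
    where
    inverse = #⇒invertible xy#0
    u = proj₁ inverse
    uxy≈1 : u * x * (y - 0#) ≈ 1#
    uxy≈1 = trans (solve 3 (λ u x y → u :* x :* (y :- ♯ 0) := u :* (x :* y :- ♯ 0))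
        refl u x y) (proj₁ (proj₂ inverse))

  0<⇒#0 : 0# < x → x # 0#
  0<⇒#0 0<x = Equivalence.from (#⇔<⊎> _ _) (inj₂ 0<x)

  <0⇒#0 : x < 0# → x # 0#
  <0⇒#0 x<0 = Equivalence.from (#⇔<⊎> _ _) (inj₁ x<0)

  #-resp-≈ : x ≈ y → x # 0# → y # 0#
  #-resp-≈ x≈y x#0 = Equivalence.from (#⇔<⊎> _ _)
    (Sum.map (<-respˡ-≈ x≈y) (<-respʳ-≈ x≈y) (Equivalence.to (#⇔<⊎> _ _) x#0))

  x<0⇒0<-x : x < 0# → 0# < - x
  x<0⇒0<-x x<0 = <-respʳ-≈ (+-identityˡ _) (<⇒0<- x<0)

  -- The signs of x and y cannot be decided in general. But a negative product, assumed for
  -- contradiction, is invertible, hence so are its factors, and their signs become decidable.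
  0≤* : 0# ≤ x → 0# ≤ y → 0# ≤ x * y
  0≤* {x} {y} 0≤x 0≤y xy<0 =
    [ 0≤x , (λ 0<x → [ 0≤y , (λ 0<y → <-asym xy<0 (*-positive 0<x 0<y)) ]′ sign-y) ]′ sign-x
    where
    sign-x : x < 0# ⊎ 0# < x
    sign-x = sign-of-factor (#-resp-≈ (*-comm x y) (<0⇒#0 xy<0))
    sign-y : y < 0# ⊎ 0# < y
    sign-y = sign-of-factor (<0⇒#0 xy<0)

  0≤x² : ∀ x → 0# ≤ x * x
  0≤x² x x²<0 = [ negative , (λ 0<x → <-asym x²<0 (*-positive 0<x 0<x)) ]′ (sign-of-factor (<0⇒#0 x²<0))
    where
    negative : ¬ x < 0#
    negative x<0 = <-asym x²<0 (<-respʳ-≈ (solve 1 (λ x → :- x :* :- x := x :* x) refl x)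
      (*-positive (x<0⇒0<-x x<0) (x<0⇒0<-x x<0)))

  0<-cancel-* : 0# ≤ x → 0# < x * y → 0# < y
  0<-cancel-* {x} {y} 0≤x 0<xy = [ ⊥-elim ∘ negative , (λ 0<y → 0<y) ]′ (sign-of-factor (0<⇒#0 0<xy))
    where
    negative : ¬ y < 0#
    negative y<0 = 0≤* 0≤x (<⇒≤ (x<0⇒0<-x y<0))
      (0<-⇒< (<-respʳ-≈ (solve 2 (λ x y → x :* y := ♯ 0 :- x :* :- y) refl x y) 0<xy))

  0≤-cancel-* : 0# < x → 0# ≤ x * y → 0# ≤ y
  0≤-cancel-* {x} {y} 0<x 0≤xy y<0 = 0≤xy (0<-⇒< (<-respʳ-≈
    (solve 2 (λ x y → x :* :- y := ♯ 0 :- x :* y) refl x y) (*-positive 0<x (x<0⇒0<-x y<0))))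

  *-cancelˡ-< : 0# ≤ z → z * x < z * y → x < y
  *-cancelˡ-< {z} {x} {y} 0≤z zx<zy = 0<-⇒< (0<-cancel-* 0≤z (<-respʳ-≈
    (solve 3 (λ x y z → z :* y :- z :* x := z :* (y :- x)) refl x y z) (<⇒0<- zx<zy)))

  *-cancelˡ-≤ : 0# < z → z * x ≤ z * y → x ≤ y
  *-cancelˡ-≤ {z} {x} {y} 0<z zx≤zy = 0≤-⇒≤ (0≤-cancel-* 0<z (≤-resp-≈ refl
    (solve 3 (λ x y z → z :* y :- z :* x := z :* (y :- x)) refl x y z) (≤⇒0≤- zx≤zy)))

  *-monoˡ-≤ : 0# ≤ z → x ≤ y → z * x ≤ z * y
  *-monoˡ-≤ {z} {x} {y} 0≤z x≤y = ≤-by (z * (y - x)) (0≤* 0≤z (≤⇒0≤- x≤y))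
    (solve 3 (λ x y z → z :* (y :- x) := z :* y :- z :* x) refl x y z)

  *-monoʳ-≤ : 0# ≤ z → x ≤ y → x * z ≤ y * z
  *-monoʳ-≤ 0≤z x≤y = ≤-resp-≈ (*-comm _ _) (*-comm _ _) (*-monoˡ-≤ 0≤z x≤y)

  *-monoˡ-< : 0# < z → x < y → z * x < z * y
  *-monoˡ-< {z} {x} {y} 0<z x<y = <-by (z * (y - x)) (*-positive 0<z (<⇒0<- x<y))
    (solve 3 (λ x y z → z :* (y :- x) := z :* y :- z :* x) refl x y z)

  *-mono-≤ : 0# ≤ x → 0# ≤ y′ → x ≤ x′ → y ≤ y′ → x * y ≤ x′ * y′
  *-mono-≤ 0≤x 0≤y′ x≤x′ y≤y′ = ≤-trans (*-monoˡ-≤ 0≤x y≤y′) (*-monoʳ-≤ 0≤y′ x≤x′)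

  0≤fromℕ : ∀ n → 0# ≤ fromℕ n
  0≤fromℕ zero    = ≤-refl
  0≤fromℕ (suc n) = <⇒≤ (0<fromℕ-suc n)

  fromℕ-mono-≤ : ∀ {m n} → m ℕ.≤ n → fromℕ m ≤ fromℕ n
  fromℕ-mono-≤ {m} {n} m≤n = ≤-by (fromℕ (n ℕ.∸ m)) (0≤fromℕ (n ℕ.∸ m))
    (trans (solve 2 (λ a b → b := a :+ b :- a) refl (fromℕ m) (fromℕ (n ℕ.∸ m)))
      (+-congʳ (trans (sym (fromℕ-+ m (n ℕ.∸ m))) (reflexive (≡.cong fromℕ (ℕ.m+[n∸m]≡n m≤n))))))

  fromℕ-mono-< : ∀ {m n} → m ℕ.< n → fromℕ m < fromℕ n
  fromℕ-mono-< {m} m<n = <-≤-trans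
    (<-by 1# 0<1 (solve 1 (λ m → ♯ 1 := ♯ 1 :+ m :- m) refl (fromℕ m))) (fromℕ-mono-≤ m<n)

  0<⇒invertible : 0# < x → ∃[ y ] 0# < y × x * y ≈ 1#
  0<⇒invertible {x} 0<x = x⁻¹ , 0<-cancel-* (<⇒≤ 0<x) (<-respʳ-≈ (sym xy≈1) 0<1) , xy≈1
    where
    inverse = #⇒invertible (0<⇒#0 0<x)
    x⁻¹ = proj₁ inverse
    xy≈1 : x * x⁻¹ ≈ 1#
    xy≈1 = trans (solve 2 (λ x y → x :* y := (x :- ♯ 0) :* y) refl x x⁻¹) (proj₂ (proj₂ inverse))

  0≤1 : 0# ≤ 1#
  0≤1 = <⇒≤ 0<1

  -- Limits and inverse functions

  *-self-cancel-≤ : 0# ≤ y → x * x ≤ y * y → x ≤ y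
  *-self-cancel-≤ {y} {x} 0≤y x²≤y² y<x = x²≤y² (<-by ((x - y) * (x + y))
    (*-positive (<⇒0<- y<x) (<-respʳ-≈ (+-comm y x) (≤-<-trans 0≤y (<-by x (≤-<-trans 0≤y y<x)
      (solve 2 (λ x y → x := y :+ x :- y) refl x y)))))
    (solve 2 (λ x y → (x :- y) :* (x :+ y) := x :* x :- y :* y) refl x y))

  *-self-cancel-< : 0# ≤ x → 0# ≤ y → x * x < y * y → x < y
  *-self-cancel-< {x} {y} 0≤x 0≤y x²<y² = 0<-⇒< (0<-cancel-* (0≤+ 0≤x 0≤y) (<-respʳ-≈
    (solve 2 (λ x y → y :* y :- x :* x := (x :+ y) :* (y :- x)) refl x y) (<⇒0<- x²<y²)))

  abstract
    half : Carrier
    half = proj₁ (0<⇒invertible (0<fromℕ-suc 1))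

    0<half : 0# < half
    0<half = proj₁ (proj₂ (0<⇒invertible (0<fromℕ-suc 1)))

    half+half≈1 : half + half ≈ 1#
    half+half≈1 = trans (solve 1 (λ h → h :+ h := ♯ 2 :* h) refl half) (proj₂ (proj₂ (0<⇒invertible (0<fromℕ-suc 1))))

  half*x+half*x≈x : ∀ x → half * x + half * x ≈ x
  half*x+half*x≈x x = trans (sym (distribʳ x half half)) (trans (*-congʳ half+half≈1) (*-identityˡ x))

  Eventually : (ℕ → Set) → Set
  Eventually P = ∃[ N ] ∀ n → N ℕ.≤ n → P n

  Null : (ℕ → Carrier) → Set
  Null s = ∀ ε → 0# < ε → Eventually λ n → s n < ε

  -- The Archimedean axiom enters here: once n exceeds c / ε, the bound forces s n < ε. Both the
  -- root-finding iteration and the cosine series get their convergence from this.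
  fromℕ-*-bounded⇒Null : ∀ {s} c → (∀ n → fromℕ n * s n ≤ c) → Null s
  fromℕ-*-bounded⇒Null {s} c bound ε 0<ε = N , s<ε
    where
    ε⁻¹ = proj₁ (0<⇒invertible 0<ε)
    εε⁻¹≈1 = proj₂ (proj₂ (0<⇒invertible 0<ε))
    N = proj₁ (archimedean (c * ε⁻¹))
    c<ε*N : c < ε * fromℕ N
    c<ε*N = <-respˡ-≈ (trans (solve 3 (λ ε c e → ε :* (c :* e) := c :* (ε :* e)) refl ε c ε⁻¹)
                             (trans (*-congˡ εε⁻¹≈1) (*-identityʳ c)))
                      (*-monoˡ-< 0<ε (proj₂ (archimedean (c * ε⁻¹))))
    s<ε : ∀ n → N ℕ.≤ n → s n < ε
    s<ε n N≤n = *-cancelˡ-< (0≤fromℕ n) (begin-strict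
      fromℕ n * s n  ≤⟨ bound n ⟩
      c              <⟨ c<ε*N ⟩
      ε * fromℕ N    ≤⟨ *-monoˡ-≤ (<⇒≤ 0<ε) (fromℕ-mono-≤ N≤n) ⟩
      ε * fromℕ n    ≈⟨ *-comm _ _ ⟩
      fromℕ n * ε    ∎)
      where open ≤-Reasoning

  x<x+ε : ∀ {ε} → 0# < ε → x < x + ε
  x<x+ε {x} {ε} 0<ε = <-by ε 0<ε (solve 2 (λ x ε → ε := x :+ ε :- x) refl x ε)

  Null⇒IsCauchy : ∀ {s b} → Null b →
    (∀ m n → m ℕ.≤ n → s n ≤ s m + b m × s m ≤ s n + b m) → IsCauchy s
  Null⇒IsCauchy {s} {b} null bound ε 0<ε = N , close
    where
    N = proj₁ (null ε 0<ε)
    close : ∀ m n → N ℕ.≤ m → N ℕ.≤ n → s m < s n + ε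
    close m n N≤m N≤n with ℕ.≤-total m n
    ... | inj₁ m≤n = ≤-<-trans (proj₂ (bound m n m≤n)) (+-mono-≤-< ≤-refl (proj₂ (null ε 0<ε) m N≤m))
    ... | inj₂ n≤m = ≤-<-trans (proj₁ (bound n m n≤m)) (+-mono-≤-< ≤-refl (proj₂ (null ε 0<ε) n N≤n))

  module _ {s a} (s⟶a : s ⟶ a) where

    ⟶-+ : ∀ d → (λ n → s n + d) ⟶ a + d
    ⟶-+ d ε 0<ε = proj₁ (s⟶a ε 0<ε) , λ n N≤n → let s<a+ε , a<s+ε = proj₂ (s⟶a ε 0<ε) n N≤n in
      <-respʳ-≈ (swap a ε) (+-monoˡ-< d s<a+ε) , <-respʳ-≈ (swap (s n) ε) (+-monoˡ-< d a<s+ε)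
      where
      swap : ∀ x ε → x + ε + d ≈ x + d + ε
      swap x ε = solve 3 (λ x ε d → x :+ ε :+ d := x :+ d :+ ε) refl x ε d

    ⟶-neg : (λ n → - s n) ⟶ - a
    ⟶-neg ε 0<ε = proj₁ (s⟶a ε 0<ε) , λ n N≤n → let s<a+ε , a<s+ε = proj₂ (s⟶a ε 0<ε) n N≤n in
      flip a<s+ε , flip s<a+ε
      where
      flip : ∀ {x y} → x < y + ε → - y < - x + ε
      flip {x} {y} x<y+ε = <-by (y + ε - x) (<⇒0<- x<y+ε)
        (solve 3 (λ x y ε → y :+ ε :- x := :- x :+ ε :- :- y) refl x y ε)

    ⟶-cong : ∀ {u b} → (∀ n → s n ≈ u n) → a ≈ b → u ⟶ b
    ⟶-cong s≈u a≈b ε 0<ε = proj₁ (s⟶a ε 0<ε) , λ n N≤n → let s<a+ε , a<s+ε = proj₂ (s⟶a ε 0<ε) n N≤n in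
      <-resp₂-≈ (s≈u n) (+-congʳ a≈b) s<a+ε , <-resp₂-≈ a≈b (+-congʳ (s≈u n)) a<s+ε

  ⟶-unshift : ∀ {s a} → (λ n → s (suc n)) ⟶ a → s ⟶ a
  ⟶-unshift {s} {a} shifted ε 0<ε = suc (proj₁ (shifted ε 0<ε)) , λ where
    (suc n) (ℕ.s≤s N≤n) → proj₂ (shifted ε 0<ε) n N≤n

  ⟶-shift : ∀ {s a} → s ⟶ a → (λ n → s (suc n)) ⟶ a
  ⟶-shift s⟶a ε 0<ε = proj₁ (s⟶a ε 0<ε) , λ n N≤n → proj₂ (s⟶a ε 0<ε) (suc n) (ℕ.m≤n⇒m≤1+n N≤n)

  ⟶-const : ∀ c → (λ _ → c) ⟶ c
  ⟶-const c ε 0<ε = 0 , λ _ _ → x<x+ε 0<ε , x<x+ε 0<ε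

  ⟶-mono-≤ : ∀ {s u a b} → s ⟶ a → u ⟶ b → Eventually (λ n → s n ≤ u n) → a ≤ b
  ⟶-mono-≤ {s} {u} {a} {b} s⟶a u⟶b (N , s≤u) b<a = <-irrefl refl (begin-strict
    a              <⟨ proj₂ (proj₂ (s⟶a ε 0<ε) n (ℕ.≤-trans (ℕ.m≤m⊔n Ns Nu) Nsu≤n)) ⟩
    s n + ε        ≤⟨ +-mono-≤ (s≤u n (ℕ.m≤m⊔n N _)) ≤-refl ⟩
    u n + ε        <⟨ +-monoˡ-< ε (proj₁ (proj₂ (u⟶b ε 0<ε) n (ℕ.≤-trans (ℕ.m≤n⊔m Ns Nu) Nsu≤n))) ⟩
    b + ε + ε      ≈⟨ +-assoc b ε ε ⟩
    b + (ε + ε)    ≈⟨ +-congˡ (half*x+half*x≈x (a - b)) ⟩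
    b + (a - b)    ≈⟨ solve 2 (λ a b → b :+ (a :- b) := a) refl a b ⟩
    a              ∎)
    where
    open ≤-Reasoning
    ε = half * (a - b)
    0<ε : 0# < ε
    0<ε = *-positive 0<half (<⇒0<- b<a)
    Ns = proj₁ (s⟶a ε 0<ε)
    Nu = proj₁ (u⟶b ε 0<ε)
    n = N ℕ.⊔ (Ns ℕ.⊔ Nu)
    Nsu≤n : Ns ℕ.⊔ Nu ℕ.≤ n
    Nsu≤n = ℕ.m≤n⊔m N (Ns ℕ.⊔ Nu)

  ⟶-unique : ∀ {s a b} → s ⟶ a → s ⟶ b → a ≈ b
  ⟶-unique s⟶a s⟶b = ≤-antisym (⟶-mono-≤ s⟶a s⟶b (0 , λ _ _ → ≤-refl)) (⟶-mono-≤ s⟶b s⟶a (0 , λ _ _ → ≤-refl))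

  -- Functions on an interval receive the membership proofs, because `versine` needs them to show
  -- that its series converges.
  Interval : Carrier → Carrier → Set
  Interval lo hi = ∃[ x ] lo ≤ x × x ≤ hi

  -- Since κ (f y - f x) ≤ y - x, the iteration x ↦ x + κ (t - f x) never
  -- overshoots.  Its residuals e n decrease and ∑ κ (e n) ≤ hi - lo, whence
  -- n κ (e n) ≤ hi - lo.
  module _ {lo hi κ : Carrier} (f : Interval lo hi → Carrier) (0<κ : 0# < κ)
    (monotone : ∀ x y → proj₁ x ≤ proj₁ y → f x ≤ f y)
    (lipschitz : ∀ x y → proj₁ x ≤ proj₁ y → κ * (f y - f x) ≤ proj₁ y - proj₁ x)
    (injective : ∀ ε → 0# < ε → ∃[ δ ] 0# < δ × (∀ x y → proj₁ x ≤ proj₁ y → f y < f x + δ → proj₁ y < proj₁ x + ε))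
    where

    intermediate-value : ∀ a b t → proj₁ a ≤ lo → hi ≤ proj₁ b → f a ≤ t → t ≤ f b → ∃[ x ] f x ≈ t
    intermediate-value a b@(_ , _ , b≤hi) t a≤lo hi≤b fa≤t t≤fb = limit , ≤-antisym fl≤t t≤fl
      where
      next : ∀ x → f x ≤ t → ∃[ x⁺ ] f x⁺ ≤ t × proj₁ x ≤ proj₁ x⁺
      next x@(v , lo≤v , v≤hi) fx≤t = x⁺ , fx⁺≤t , v≤v⁺
        where
        v⁺ = v + κ * (t - f x)
        v≤v⁺ : v ≤ v⁺
        v≤v⁺ = ≤-by (κ * (t - f x)) (0≤* (<⇒≤ 0<κ) (≤⇒0≤- fx≤t))
          (solve 2 (λ x d → d := x :+ d :- x) refl v (κ * (t - f x)))
        v⁺≤hi : v⁺ ≤ hi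
        v⁺≤hi = begin
          v + κ * (t - f x)      ≤⟨ +-mono-≤ ≤-refl (*-monoˡ-≤ (<⇒≤ 0<κ) (+-mono-≤ t≤fb ≤-refl)) ⟩
          v + κ * (f b - f x)    ≤⟨ +-mono-≤ ≤-refl (lipschitz x b (≤-trans v≤hi hi≤b)) ⟩
          v + (proj₁ b - v)      ≈⟨ solve 2 (λ x h → x :+ (h :- x) := h) refl v (proj₁ b) ⟩
          proj₁ b                ≤⟨ b≤hi ⟩
          hi                     ∎
          where open ≤-Reasoning
        x⁺ : Interval lo hi
        x⁺ = v⁺ , ≤-trans lo≤v v≤v⁺ , v⁺≤hi
        fx⁺≤t : f x⁺ ≤ t
        fx⁺≤t = 0≤-⇒≤ (0≤-cancel-* 0<κ (≤-resp-≈ refl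
          (solve 5 (λ x κ t a b → x :+ κ :* (t :- a) :- x :- κ :* (b :- a) := κ :* (t :- b)) refl v κ t (f x) (f x⁺))
          (≤⇒0≤- (lipschitz x x⁺ v≤v⁺))))

      iterate : ℕ → ∃[ x ] f x ≤ t
      iterate zero    = a , fa≤t
      iterate (suc n) = let x , fx≤t = iterate n ; x⁺ , fx⁺≤t , _ = next x fx≤t in x⁺ , fx⁺≤t

      xs : ℕ → Interval lo hi
      xs n = proj₁ (iterate n)

      v : ℕ → Carrier
      v n = proj₁ (xs n)

      v≤hi : ∀ n → v n ≤ hi
      v≤hi n = proj₂ (proj₂ (xs n))

      e : ℕ → Carrier
      e n = t - f (xs n)

      v-step : ∀ n → v n ≤ v (suc n)
      v-step n = proj₂ (proj₂ (next (xs n) (proj₂ (iterate n))))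

      v-mono : ∀ {m n} → m ℕ.≤ n → v m ≤ v n
      v-mono = go ∘ ℕ.≤⇒≤′
        where
        go : ∀ {m n} → m ℕ.≤′ n → v m ≤ v n
        go ℕ.≤′-refl       = ≤-refl
        go {n = suc n} (ℕ.≤′-step m≤n) = ≤-trans (go m≤n) (v-step n)

      n*κe≤ : ∀ n → fromℕ n * (κ * e n) ≤ v n - v 0
      n*κe≤ zero    = ≤-reflexive (solve 2 (λ a b → ♯ 0 :* a := b :- b) refl (κ * e 0) (v 0))
      n*κe≤ (suc n) = begin
        fromℕ (suc n) * (κ * e (suc n))  ≤⟨ *-monoˡ-≤ (0≤fromℕ (suc n)) (*-monoˡ-≤ (<⇒≤ 0<κ) e-step) ⟩
        (1# + fromℕ n) * (κ * e n)       ≈⟨ solve 2 (λ n d → (♯ 1 :+ n) :* d := n :* d :+ d)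
            refl (fromℕ n) (κ * e n) ⟩
        fromℕ n * (κ * e n) + κ * e n    ≤⟨ +-mono-≤ (n*κe≤ n) ≤-refl ⟩
        v n - v 0 + κ * e n              ≈⟨ solve 3 (λ x l d → x :- l :+ d := x :+ d :- l)
            refl (v n) (v 0) (κ * e n) ⟩
        v (suc n) - v 0                  ∎
        where
        open ≤-Reasoning
        e-step : e (suc n) ≤ e n
        e-step = ≤-by (f (xs (suc n)) - f (xs n)) (≤⇒0≤- (monotone (xs n) (xs (suc n)) (v-step n)))
          (solve 3 (λ t a b → b :- a := t :- a :- (t :- b)) refl t (f (xs n)) (f (xs (suc n))))

      κe-null : Null (λ n → κ * e n)
      κe-null = fromℕ-*-bounded⇒Null (hi - v 0) (λ n → ≤-trans (n*κe≤ n) (+-mono-≤ (v≤hi n) ≤-refl))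

      e-null : Null e
      e-null ε 0<ε = proj₁ (κe-null (κ * ε) (*-positive 0<κ 0<ε)) , λ n N≤n →
        *-cancelˡ-< (<⇒≤ 0<κ) (proj₂ (κe-null (κ * ε) (*-positive 0<κ 0<ε)) n N≤n)

      -- A bounded increasing sequence need not converge constructively. Small residuals make the
      -- values close, and the modulus in `injective` then makes the arguments close.
      v-cauchy : IsCauchy v
      v-cauchy ε 0<ε = N , close
        where
        δ = proj₁ (injective ε 0<ε)
        0<δ = proj₁ (proj₂ (injective ε 0<ε))
        N = proj₁ (e-null δ 0<δ)
        close : ∀ m n → N ℕ.≤ m → N ℕ.≤ n → v m < v n + ε
        close m n N≤m N≤n with ℕ.≤-total m n
        ... | inj₁ m≤n = ≤-<-trans (v-mono m≤n) (x<x+ε 0<ε)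
        ... | inj₂ n≤m = proj₂ (proj₂ (injective ε 0<ε)) (xs n) (xs m) (v-mono n≤m)
            (≤-<-trans (proj₂ (iterate m))
              (<-by (δ - e n) (<⇒0<- (proj₂ (e-null δ 0<δ) n N≤n))
                (solve 3 (λ t a d → d :- (t :- a) := a :+ d :- t) refl t (f (xs n)) δ)))

      l : Carrier
      l = proj₁ (complete v v-cauchy)

      v⟶l : v ⟶ l
      v⟶l = proj₂ (complete v v-cauchy)

      v≤l : ∀ n → v n ≤ l
      v≤l n = ⟶-mono-≤ (⟶-const (v n)) v⟶l (n , λ _ n≤m → v-mono n≤m)

      limit : Interval lo hi
      limit = l , ≤-trans (proj₁ (proj₂ a)) (v≤l 0) , ⟶-mono-≤ v⟶l (⟶-const hi) (0 , λ n _ → v≤hi n)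

      t≤fl : t ≤ f limit
      t≤fl fl<t = monotone (xs n) limit (v≤l n)
        (<-by (t - f limit - e n) (<⇒0<- (proj₂ (e-null (t - f limit) (<⇒0<- fl<t)) n ℕ.≤-refl))
          (solve 3 (λ t a b → t :- b :- (t :- a) := a :- b) refl t (f (xs n)) (f limit)))
        where n = proj₁ (e-null (t - f limit) (<⇒0<- fl<t))

      -- If f l exceeded t, then at an iterate within κ (f l - t) of l the Lipschitz bound would
      -- already give a value above t, but the iterates never overshoot.
      fl≤t : f limit ≤ t
      fl≤t t<fl = proj₂ (iterate n) (*-cancelˡ-< (<⇒≤ 0<κ) (0<-⇒< (<-respʳ-≈
          (solve 5 (λ κ t a b d → (κ :* (b :- t) :- d) :+ (d :- κ :* (b :- a)) := κ :* a :- κ :* t)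
            refl κ t (f (xs n)) (f limit) (l - v n))
          (0<+ (<⇒0<- l-v<κδ) (≤⇒0≤- (lipschitz (xs n) limit (v≤l n)))))))
        where
        0<κδ = *-positive 0<κ (<⇒0<- t<fl)
        n = proj₁ (v⟶l (κ * (f limit - t)) 0<κδ)
        l-v<κδ : l - v n < κ * (f limit - t)
        l-v<κδ = <-by (v n + κ * (f limit - t) - l) (<⇒0<- (proj₂ (proj₂ (v⟶l (κ * (f limit - t)) 0<κδ) n ℕ.≤-refl)))
          (solve 3 (λ x d l → x :+ d :- l := d :- (l :- x)) refl (v n) (κ * (f limit - t)) l)

  abstract
    -- On [0 , 2] squaring has slope at most 4 = 1 / κ. Its slope vanishes at 0, so the modulus of
    -- injectivity is δ = ε²: y² < x² + ε² ≤ (x + ε)².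
    sqrt : ∀ t → 0# ≤ t → t ≤ fromℕ 4 → ∃[ s ] 0# ≤ s × s ≤ fromℕ 2 × s * s ≈ t
    sqrt t 0≤t t≤4 = let (s , 0≤s , s≤2) , s²≈t = root in s , 0≤s , s≤2 , s²≈t
      where
      κ : Carrier
      κ = proj₁ (0<⇒invertible (0<fromℕ-suc 3))
      0<κ : 0# < κ
      0<κ = proj₁ (proj₂ (0<⇒invertible (0<fromℕ-suc 3)))
      4κ≈1 : fromℕ 4 * κ ≈ 1#
      4κ≈1 = proj₂ (proj₂ (0<⇒invertible (0<fromℕ-suc 3)))
      square : Interval 0# (fromℕ 2) → Carrier
      square (x , _) = x * x
      monotone : ∀ x y → proj₁ x ≤ proj₁ y → square x ≤ square y
      monotone (x , 0≤x , _) (y , 0≤y , _) x≤y = *-mono-≤ 0≤x 0≤y x≤y x≤y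
      lipschitz : ∀ x y → proj₁ x ≤ proj₁ y → κ * (square y - square x) ≤ proj₁ y - proj₁ x
      lipschitz (x , _ , x≤2) (y , _ , y≤2) x≤y = ≤-by (κ * ((y - x) * (fromℕ 2 - y + (fromℕ 2 - x))))
        (0≤* (<⇒≤ 0<κ) (0≤* (≤⇒0≤- x≤y) (0≤+ (≤⇒0≤- y≤2) (≤⇒0≤- x≤2))))
        (trans (solve 3 (λ κ x y → κ :* ((y :- x) :* (♯ 2 :- y :+ (♯ 2 :- x)))
                 := ♯ 4 :* κ :* (y :- x) :- κ :* (y :* y :- x :* x)) refl κ x y)
               (+-congʳ (trans (*-congʳ 4κ≈1) (*-identityˡ _))))
      injective : ∀ ε → 0# < ε → ∃[ δ ] 0# < δ ×
        (∀ x y → proj₁ x ≤ proj₁ y → square y < square x + δ → proj₁ y < proj₁ x + ε)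
      injective ε 0<ε = ε * ε , *-positive 0<ε 0<ε , λ (x , 0≤x , _) (y , 0≤y , _) x≤y y²<x²+ε² →
        *-self-cancel-< 0≤y (0≤+ 0≤x (<⇒≤ 0<ε)) (<-≤-trans y²<x²+ε²
          (≤-by (fromℕ 2 * (x * ε)) (0≤* (0≤fromℕ 2) (0≤* 0≤x (<⇒≤ 0<ε)))
            (solve 2 (λ x ε → ♯ 2 :* (x :* ε) := (x :+ ε) :* (x :+ ε) :- (x :* x :+ ε :* ε)) refl x ε)))
      root : ∃[ s ] square s ≈ t
      root = intermediate-value square 0<κ monotone lipschitz injective
        (0# , ≤-refl , 0≤fromℕ 2) (fromℕ 2 , 0≤fromℕ 2 , ≤-refl) t ≤-refl ≤-refl
        (≤-resp-≈ (sym (zeroˡ 0#)) refl 0≤t)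
        (≤-resp-≈ refl (solve 0 (♯ 4 := ♯ 2 :* ♯ 2) refl) t≤4)

  -- The cosine series

  -- Subtracting the sum of the tail, instead of carrying signs (-1)ⁱ, lets the Leibniz bounds
  -- follow by induction over the tails of the sequence.
  alternatingSum : (ℕ → Carrier) → ℕ → Carrier
  alternatingSum t zero    = 0#
  alternatingSum t (suc l) = t 0 - alternatingSum (t ∘ suc) l

  alternatingSum-minus : ∀ t u l → alternatingSum (λ i → t i - u i) l ≈ alternatingSum t l - alternatingSum u l
  alternatingSum-minus t u zero    = solve 0 (♯ 0 := ♯ 0 :- ♯ 0) refl
  alternatingSum-minus t u (suc l) = trans (+-congˡ (-‿cong (alternatingSum-minus (t ∘ suc) (u ∘ suc) l)))
    (solve 4 (λ a b c d → a :- b :- (c :- d) := a :- c :- (b :- d)) refl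
      (t 0) (u 0) (alternatingSum (t ∘ suc) l) (alternatingSum (u ∘ suc) l))

  -- The generalisation over σ carries the induction: passing to the tail replaces σ by - σ.
  sum≈alternatingSum : ∀ σ {b t : ℕ → Carrier} → (∀ i → b i ≈ σ * ((- 1#) ^ i * t i)) →
    ∀ n → sum {n} (b ∘ toℕ) ≈ σ * alternatingSum t n
  sum≈alternatingSum σ b≈ zero    = sym (zeroʳ σ)
  sum≈alternatingSum σ {b} {t} b≈ (suc n) = trans
    (+-cong (b≈ 0) (sum≈alternatingSum (- σ) {b ∘ suc} {t ∘ suc} (λ i → trans (b≈ (suc i))
      (solve 3 (λ σ p t → σ :* (:- ♯ 1 :* p :* t) := :- σ :* (p :* t)) refl σ ((- 1#) ^ i) (t (suc i)))) n))
    (solve 3 (λ σ a b → σ :* (♯ 1 :* a) :+ :- σ :* b := σ :* (a :- b)) refl σ (t 0) (alternatingSum (t ∘ suc) n))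

  -- The fields say nonnegative and antitone; that the terms become small is a separate fact,
  -- `versineTerm-null`.
  record DecreasesTo0 (t : ℕ → Carrier) : Set where
    constructor decreases
    field
      nonnegative : ∀ i → 0# ≤ t i
      antitone    : ∀ i → t (suc i) ≤ t i

  open DecreasesTo0

  tail : ∀ {t} → DecreasesTo0 t → DecreasesTo0 (t ∘ suc)
  tail d = decreases (nonnegative d ∘ suc) (antitone d ∘ suc)

  alternatingSum-bounds : ∀ {t} → DecreasesTo0 t → ∀ l → 0# ≤ alternatingSum t l × alternatingSum t l ≤ t 0
  alternatingSum-bounds d zero = ≤-refl , nonnegative d 0
  alternatingSum-bounds d (suc l) = let 0≤A , A≤t₁ = alternatingSum-bounds (tail d) l in
    ≤⇒0≤- (≤-trans A≤t₁ (antitone d 0)) ,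
    ≤-by _ 0≤A (solve 2 (λ a b → b := a :- (a :- b)) refl _ _)

  alternatingSum-lower-bound : ∀ {t} → DecreasesTo0 t → ∀ l → t 0 - t 1 ≤ alternatingSum t (suc l)
  alternatingSum-lower-bound {t} d l = ≤-by _ (≤⇒0≤- (proj₂ (alternatingSum-bounds (tail d) l)))
    (solve 3 (λ a b c → b :- c := a :- c :- (a :- b)) refl (t 0) (t 1) _)

  -- The error of a Leibniz series is at most the first omitted term. Both directions are proved
  -- together, since removing the leading term negates the difference and exchanges them.
  alternatingSum-close : ∀ {t} → DecreasesTo0 t → ∀ m n → m ℕ.≤ n →
    alternatingSum t n ≤ alternatingSum t m + t m × alternatingSum t m ≤ alternatingSum t n + t m
  alternatingSum-close {t} d zero n _ = let 0≤A , A≤t₀ = alternatingSum-bounds d n in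
    ≤-resp-≈ refl (sym (+-identityˡ (t 0))) A≤t₀ , 0≤+ 0≤A (nonnegative d 0)
  alternatingSum-close {t} d (suc m) (suc n) (ℕ.s≤s m≤n) = let An≤ , Am≤ = alternatingSum-close (tail d) m n m≤n in
    flip Am≤ , flip An≤
    where
    flip : ∀ {x y ε} → x ≤ y + ε → t 0 - y ≤ t 0 - x + ε
    flip {x} {y} {ε} x≤y+ε = ≤-by (y + ε - x) (≤⇒0≤- x≤y+ε)
      (solve 4 (λ t x y ε → y :+ ε :- x := t :- x :+ ε :- (t :- y)) refl (t 0) x y ε)

  abstract
    -- The coefficient 1 / (2i)!, opaque so that inverses of factorials are never unfolded during
    -- type checking.
    ρ : ℕ → Carrier
    ρ i = recip ((2 ℕ.* i) ℕ.!) {{(2 ℕ.* i) ℕ.!≢0}}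

    [2i]!*ρ≈1 : ∀ i → fromℕ ((2 ℕ.* i) ℕ.!) * ρ i ≈ 1#
    [2i]!*ρ≈1 i = proj₂ (fromℕ-invertible ((2 ℕ.* i) ℕ.!) {{(2 ℕ.* i) ℕ.!≢0}})

    -- Stated inside the `abstract` block, where `ρ` still unfolds and `refl` suffices.
    cosTerm≈ : ∀ x i → cosTerm ℝ x i ≈ (- 1#) ^ i * x ^ (2 ℕ.* i) * ρ i
    cosTerm≈ x i = refl

  -- The quotient (2i + 2)! / (2i)!.
  ratio : ℕ → ℕ
  ratio i = (2 ℕ.+ 2 ℕ.* i) ℕ.* (1 ℕ.+ 2 ℕ.* i)

  0<ρ : ∀ i → 0# < ρ i
  0<ρ i = 0<-cancel-* (0≤fromℕ ((2 ℕ.* i) ℕ.!)) (<-respʳ-≈ (sym ([2i]!*ρ≈1 i)) 0<1)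

  ρ-step : ∀ i → ρ i ≈ fromℕ (ratio i) * ρ (suc i)
  ρ-step i = begin
    ρ i                                       ≈⟨ *-identityʳ _ ⟨
    ρ i * 1#                                  ≈⟨ *-congˡ ([2i]!*ρ≈1 (suc i)) ⟨
    ρ i * (fromℕ ((2 ℕ.* suc i) ℕ.!) * ρ (suc i)) ≡⟨ ≡.cong (λ m → ρ i * (fromℕ m * ρ (suc i))) [2+2i]! ⟩
    ρ i * (fromℕ (ratio i ℕ.* (2 ℕ.* i) ℕ.!) * ρ (suc i)) ≈⟨ *-congˡ (*-congʳ (×1-homo-* (ratio i) ((2 ℕ.* i) ℕ.!))) ⟩
    ρ i * (fromℕ (ratio i) * F * ρ (suc i))   ≈⟨ solve 4 (λ r q F s → r :* (q :* F :* s)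
        := F :* r :* (q :* s)) refl (ρ i) (fromℕ (ratio i)) F (ρ (suc i)) ⟩
    F * ρ i * (fromℕ (ratio i) * ρ (suc i))   ≈⟨ *-congʳ ([2i]!*ρ≈1 i) ⟩
    1# * (fromℕ (ratio i) * ρ (suc i))        ≈⟨ *-identityˡ _ ⟩
    fromℕ (ratio i) * ρ (suc i)               ∎
    where
    open Relation.Binary.Reasoning.Setoid setoid
    F = fromℕ ((2 ℕ.* i) ℕ.!)
    [2+2i]! : (2 ℕ.* suc i) ℕ.! ≡ ratio i ℕ.* (2 ℕ.* i) ℕ.!
    [2+2i]! = ≡.trans (≡.cong ℕ._! (ℕ.*-suc 2 i)) (≡.sym (ℕ.*-assoc (2 ℕ.+ 2 ℕ.* i) (1 ℕ.+ 2 ℕ.* i) ((2 ℕ.* i) ℕ.!)))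

  ρ₀≈1 : ρ 0 ≈ 1#
  ρ₀≈1 = trans (solve 1 (λ r → r := (♯ 1 :+ ♯ 0) :* r) refl (ρ 0)) ([2i]!*ρ≈1 0)

  2ρ₁≈1 : fromℕ 2 * ρ 1 ≈ 1#
  2ρ₁≈1 = [2i]!*ρ≈1 1

  24ρ₂≈1 : fromℕ 24 * ρ 2 ≈ 1#
  24ρ₂≈1 = [2i]!*ρ≈1 2

  ρ₁≈12ρ₂ : ρ 1 ≈ fromℕ 12 * ρ 2
  ρ₁≈12ρ₂ = ρ-step 1

  12≤ratio : ∀ i → 12 ℕ.≤ ratio (suc i)
  12≤ratio i = ℕ.*-mono-≤ {4} {_} {3} (ℕ.s≤s (ℕ.s≤s 2≤)) (ℕ.s≤s 2≤)
    where
    2≤ : 2 ℕ.≤ 2 ℕ.* suc i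
    2≤ = ℕ.*-monoʳ-≤ 2 (ℕ.s≤s (ℕ.z≤n {i}))

  -- Linear growth is enough for convergence: for X ≤ 4 it gives (2 + i) τ (i + 1) ≤ τ i for the
  -- terms τ of the versine series.
  4[2+i]≤ratio : ∀ i → 4 ℕ.* (2 ℕ.+ i) ℕ.≤ ratio (suc i)
  4[2+i]≤ratio i = ≡.subst (4 ℕ.* (2 ℕ.+ i) ℕ.≤_) (expand i) (ℕ.m≤m+n _ _)
    where
    expand : ∀ i → 4 ℕ.* (2 ℕ.+ i) ℕ.+ (4 ℕ.+ 10 ℕ.* i ℕ.+ 4 ℕ.* (i ℕ.* i)) ≡ (2 ℕ.+ 2 ℕ.* suc i) ℕ.*
        (1 ℕ.+ 2 ℕ.* suc i)
    expand = solve-∀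

  -- From `ρ 1` on, each coefficient is at least 12 times the next, which absorbs any growth of the
  -- weights by a factor c ≤ 12. It serves the series itself with c = X ≤ 4 and differences of two
  -- series with c = Y + X ≤ 8.
  weighted-decreases : ∀ (E : ℕ → Carrier) {c} → c ≤ fromℕ 12 → (∀ i → 0# ≤ E i) → (∀ i → E (suc i) ≤ c * E i) →
    DecreasesTo0 (λ i → E i * ρ (suc i))
  weighted-decreases E {c} c≤12 0≤E growth = decreases (λ i → 0≤* (0≤E i) (<⇒≤ (0<ρ (suc i)))) λ i → begin
    E (suc i) * ρ (2 ℕ.+ i)                             ≤⟨ *-monoʳ-≤ (<⇒≤ (0<ρ (2 ℕ.+ i))) (growth i) ⟩
    c * E i * ρ (2 ℕ.+ i)                               ≤⟨ *-monoʳ-≤ (<⇒≤ (0<ρ (2 ℕ.+ i))) (*-monoʳ-≤ (0≤E i)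
        (≤-trans c≤12 (fromℕ-mono-≤ (12≤ratio i)))) ⟩
    fromℕ (ratio (suc i)) * E i * ρ (2 ℕ.+ i)           ≈⟨ solve 3 (λ q e r → q :* e :* r := e :* (q :* r))
        refl (fromℕ (ratio (suc i))) (E i) (ρ (2 ℕ.+ i)) ⟩
    E i * (fromℕ (ratio (suc i)) * ρ (2 ℕ.+ i))         ≈⟨ *-congˡ (ρ-step (suc i)) ⟨
    E i * ρ (suc i)                                     ∎
    where
    open ≤-Reasoning

  0≤^ : 0# ≤ x → ∀ n → 0# ≤ x ^ n
  0≤^ 0≤x zero    = 0≤1
  0≤^ 0≤x (suc n) = 0≤* 0≤x (0≤^ 0≤x n)

  ^-mono-≤ : 0# ≤ x → x ≤ y → ∀ n → x ^ n ≤ y ^ n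
  ^-mono-≤ 0≤x x≤y zero    = ≤-refl
  ^-mono-≤ 0≤x x≤y (suc n) = *-mono-≤ 0≤x (0≤^ (≤-trans 0≤x x≤y) n) x≤y (^-mono-≤ 0≤x x≤y n)

  Domain : Set
  Domain = Interval 0# (fromℕ 4)

  -- The series of 1 - cos x in terms of x².

  versineTerm : Carrier → ℕ → Carrier
  versineTerm X i = X ^ suc i * ρ (suc i)

  module _ (X̂ : Domain) where
    private
      X : Carrier
      X = proj₁ X̂
      0≤X : 0# ≤ X
      0≤X = proj₁ (proj₂ X̂)
      X≤4 : X ≤ fromℕ 4
      X≤4 = proj₂ (proj₂ X̂)

    versineTerm-decreases : DecreasesTo0 (versineTerm X)
    versineTerm-decreases = weighted-decreases (λ i → X ^ suc i) (≤-trans X≤4 (fromℕ-mono-≤ (ℕ.m≤m+n 4 8)))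
      (λ i → 0≤^ 0≤X (suc i)) (λ i → ≤-refl)

    versineTerm-0≤4 : versineTerm X 0 ≤ fromℕ 4
    versineTerm-0≤4 = begin
      X * 1# * ρ 1             ≤⟨ *-mono-≤ (0≤* 0≤X 0≤1) 0≤1 (≤-resp-≈ (sym (*-identityʳ X)) refl X≤4) ρ₁≤1 ⟩
      fromℕ 4 * 1#             ≈⟨ *-identityʳ _ ⟩
      fromℕ 4                  ∎
      where
      open ≤-Reasoning
      ρ₁≤1 : ρ 1 ≤ 1#
      ρ₁≤1 = ≤-by (ρ 1) (<⇒≤ (0<ρ 1)) (trans (solve 1 (λ r → r := ♯ 2 :* r :- r) refl (ρ 1)) (+-congʳ 2ρ₁≈1))

    versineTerm-null : Null (versineTerm X ∘ suc)
    versineTerm-null = fromℕ-*-bounded⇒Null (fromℕ 4) λ i → begin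
      fromℕ i * τ (suc i)                     ≤⟨ *-monoʳ-≤ (nonnegative versineTerm-decreases (suc i))
          (fromℕ-mono-≤ (ℕ.m≤n+m i 2)) ⟩
      fromℕ (2 ℕ.+ i) * τ (suc i)             ≤⟨ *-cancelˡ-≤ (0<fromℕ-suc 3) (bound i) ⟩
      τ i                                     ≤⟨ below-first i ⟩
      τ 0                                     ≤⟨ versineTerm-0≤4 ⟩
      fromℕ 4                                 ∎
      where
      open ≤-Reasoning
      τ = versineTerm X
      below-first : ∀ i → τ i ≤ τ 0
      below-first zero    = ≤-refl
      below-first (suc i) = ≤-trans (antitone versineTerm-decreases i) (below-first i)
      bound : ∀ i → fromℕ 4 * (fromℕ (2 ℕ.+ i) * τ (suc i)) ≤ fromℕ 4 * τ i
      bound i = begin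
        fromℕ 4 * (fromℕ (2 ℕ.+ i) * τ (suc i))  ≈⟨ *-assoc _ _ _ ⟨
        fromℕ 4 * fromℕ (2 ℕ.+ i) * τ (suc i)    ≈⟨ *-congʳ (×1-homo-* 4 (2 ℕ.+ i)) ⟨
        fromℕ (4 ℕ.* (2 ℕ.+ i)) * τ (suc i)      ≤⟨ *-monoʳ-≤ (nonnegative versineTerm-decreases (suc i))
            (fromℕ-mono-≤ (4[2+i]≤ratio i)) ⟩
        fromℕ (ratio (suc i)) * τ (suc i)        ≈⟨ solve 4 (λ q X p r → q :* (X :* p :* r)
            := X :* (p :* (q :* r))) refl
                                                      (fromℕ (ratio (suc i))) X (X ^ suc i) (ρ (2 ℕ.+ i)) ⟩
        X * (X ^ suc i * (fromℕ (ratio (suc i)) * ρ (2 ℕ.+ i))) ≈⟨ *-congˡ (*-congˡ (ρ-step (suc i))) ⟨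
        X * τ i                                  ≤⟨ *-monoʳ-≤ (nonnegative versineTerm-decreases i) X≤4 ⟩
        fromℕ 4 * τ i                            ∎

    -- Starting with one term rather than none makes `alternatingSum-lower-bound` apply to every
    -- partial sum.
    versineSum : ℕ → Carrier
    versineSum l = alternatingSum (versineTerm X) (suc l)

    versineSum-cauchy : IsCauchy versineSum
    versineSum-cauchy = Null⇒IsCauchy versineTerm-null λ m n m≤n →
      alternatingSum-close versineTerm-decreases (suc m) (suc n) (ℕ.s≤s m≤n)

    versine : Carrier
    versine = proj₁ (complete versineSum versineSum-cauchy)

    versineSum⟶versine : versineSum ⟶ versine
    versineSum⟶versine = proj₂ (complete versineSum versineSum-cauchy)

    versine-upper-bound : versine ≤ X * ρ 1
    versine-upper-bound = ⟶-mono-≤ versineSum⟶versine (⟶-const _)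
      (0 , λ l _ → ≤-resp-≈ refl (*-congʳ (*-identityʳ X)) (proj₂ (alternatingSum-bounds versineTerm-decreases
          (suc l))))

    versine-lower-bound : X * ρ 1 - X * X * ρ 2 ≤ versine
    versine-lower-bound = ⟶-mono-≤ (⟶-const _) versineSum⟶versine
      (0 , λ l _ → ≤-resp-≈ (solve 3 (λ X r s → X :* ♯ 1 :* r :- X :* (X :* ♯ 1) :* s
          := X :* r :- X :* X :* s) refl X (ρ 1) (ρ 2)) refl
        (alternatingSum-lower-bound versineTerm-decreases l))

    -- The index shifts by two: one for the constant term 1 of the cosine, one because
    -- `versineSum l` has l + 1 terms.
    cosSum≈ : ∀ {x} → x * x ≈ X → ∀ l → sum {suc (suc l)} (cosTerm ℝ x ∘ toℕ) ≈ - versineSum l + 1#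
    cosSum≈ {x} x²≈X l = begin
      sum {suc (suc l)} (cosTerm ℝ x ∘ toℕ)     ≈⟨ sum≈alternatingSum 1# cosTerm≈′ (suc (suc l)) ⟩
      1# * alternatingSum (λ i → X ^ i * ρ i) (suc (suc l)) ≈⟨ solve 2 (λ r v → ♯ 1 :* (♯ 1 :* r :- v)
          := :- v :+ r) refl (ρ 0) (versineSum l) ⟩
      - versineSum l + ρ 0                      ≈⟨ +-congˡ ρ₀≈1 ⟩
      - versineSum l + 1#                       ∎
      where
      open Relation.Binary.Reasoning.Setoid setoid
      x^2i≈X^i : ∀ i → x ^ (2 ℕ.* i) ≈ X ^ i
      x^2i≈X^i i = trans (sym (^-assocʳ x 2 i)) (^-congˡ i (trans (solve 1 (λ x → x :* (x :* ♯ 1) := x :* x)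
          refl x) x²≈X))
      cosTerm≈′ : ∀ i → cosTerm ℝ x i ≈ 1# * ((- 1#) ^ i * (X ^ i * ρ i))
      cosTerm≈′ i = trans (cosTerm≈ x i) (trans (*-congʳ (*-congˡ (x^2i≈X^i i))) (solve 3 (λ σ p r → σ :* p :* r
          := ♯ 1 :* (σ :* (p :* r))) refl ((- 1#) ^ i) (X ^ i) (ρ i)))

    IsCos-versine : ∀ {x c} → x * x ≈ X → c ≈ - versine + 1# → IsCos ℝ x c
    IsCos-versine x²≈X c≈ = ⟶-unshift (⟶-unshift (⟶-cong (⟶-+ (⟶-neg versineSum⟶versine) 1#)
      (λ l → sym (cosSum≈ x²≈X l)) (sym c≈)))

    versine-IsCos : ∀ {x c} → x * x ≈ X → IsCos ℝ x c → c ≈ - versine + 1#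
    versine-IsCos x²≈X cos = ⟶-unique (⟶-cong (⟶-shift (⟶-shift cos)) (cosSum≈ x²≈X) refl)
      (⟶-+ (⟶-neg versineSum⟶versine) 1#)

  module _ (X̂ Ŷ : Domain) (X≤Y : proj₁ X̂ ≤ proj₁ Ŷ) where
    private
      X Y : Carrier
      X = proj₁ X̂
      Y = proj₁ Ŷ
      0≤X : 0# ≤ X
      0≤X = proj₁ (proj₂ X̂)
      X≤4 : X ≤ fromℕ 4
      X≤4 = proj₂ (proj₂ X̂)
      0≤Y : 0# ≤ Y
      0≤Y = proj₁ (proj₂ Ŷ)
      Y≤4 : Y ≤ fromℕ 4
      Y≤4 = proj₂ (proj₂ Ŷ)

      E : ℕ → Carrier
      E i = Y ^ suc i - X ^ suc i

      difference : ℕ → Carrier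
      difference i = E i * ρ (suc i)

      0≤Y^-X^ : ∀ n → 0# ≤ Y ^ n - X ^ n
      0≤Y^-X^ n = ≤⇒0≤- (^-mono-≤ 0≤X X≤Y n)

      -- The growth factor Y + X comes from Yⁱ⁺² - Xⁱ⁺² = (Y + X) (Yⁱ⁺¹ - Xⁱ⁺¹) - Y X (Yⁱ - Xⁱ).
      difference-decreases : DecreasesTo0 difference
      difference-decreases = weighted-decreases E {Y + X}
        (≤-trans (≤-resp-≈ refl (sym (fromℕ-+ 4 4)) (+-mono-≤ Y≤4 X≤4)) (fromℕ-mono-≤ (ℕ.m≤m+n 8 4)))
        (λ i → 0≤Y^-X^ (suc i))
        (λ i → ≤-by (Y * X * (Y ^ i - X ^ i)) (0≤* (0≤* 0≤Y 0≤X) (0≤Y^-X^ i))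
          (solve 4 (λ Y X p q → Y :* X :* (p :- q)
              := (Y :+ X) :* (Y :* p :- X :* q) :- (Y :* (Y :* p) :- X :* (X :* q)))
            refl Y X (Y ^ i) (X ^ i)))

      alternatingSum-difference : ∀ l → alternatingSum difference (suc l) ≈ versineSum Ŷ l - versineSum X̂ l
      alternatingSum-difference l = trans (alternatingSum-cong
        (λ i → solve 3 (λ a b r → (a :- b) :* r := a :* r :- b :* r)
            refl (Y ^ suc i) (X ^ suc i) (ρ (suc i))) (suc l))
        (alternatingSum-minus (versineTerm Y) (versineTerm X) (suc l))
        where
        alternatingSum-cong : ∀ {t u} → (∀ i → t i ≈ u i) → ∀ l → alternatingSum t l ≈ alternatingSum u l
        alternatingSum-cong t≈u zero    = refl
        alternatingSum-cong t≈u (suc l) = +-cong (t≈u 0) (-‿cong (alternatingSum-cong (t≈u ∘ suc) l))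

    versine-lipschitz : versine Ŷ - versine X̂ ≤ (Y - X) * ρ 1
    versine-lipschitz = ≤-by _ (≤⇒0≤- (⟶-mono-≤ (versineSum⟶versine Ŷ) (⟶-+ (versineSum⟶versine X̂) ((Y - X) * ρ 1))
      (0 , λ l _ → ≤-by _ (≤⇒0≤- (≤-resp-≈ (alternatingSum-difference l)
          (solve 3 (λ Y X r → (Y :* ♯ 1 :- X :* ♯ 1) :* r := (Y :- X) :* r) refl Y X (ρ 1))
          (proj₂ (alternatingSum-bounds difference-decreases (suc l)))))
        (solve 3 (λ a b d → d :- (a :- b) := b :+ d :- a) refl (versineSum Ŷ l) (versineSum X̂ l) _))))
      (solve 3 (λ a b d → b :+ d :- a := d :- (a :- b)) refl (versine Ŷ) (versine X̂) _)

    -- The first two terms have slope ρ₁ - (X + Y) ρ₂ ≥ ρ₁ - 8 ρ₂ = 4 ρ₂.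
    versine-expansive : fromℕ 4 * ρ 2 * (Y - X) ≤ versine Ŷ - versine X̂
    versine-expansive = ≤-by _ (≤⇒0≤- (⟶-mono-≤ (⟶-+ (versineSum⟶versine X̂) (fromℕ 4 * ρ 2 * (Y - X)))
        (versineSum⟶versine Ŷ)
      (0 , λ l _ → ≤-by _ (≤⇒0≤- (≤-resp-≈ refl (alternatingSum-difference l)
          (≤-trans first-terms (alternatingSum-lower-bound difference-decreases l))))
        (solve 3 (λ a b d → a :- b :- d := a :- (b :+ d)) refl (versineSum Ŷ l) (versineSum X̂ l) _))))
      (solve 3 (λ a b d → a :- (b :+ d) := a :- b :- d) refl (versine Ŷ) (versine X̂) _)
      where
      first-terms : fromℕ 4 * ρ 2 * (Y - X) ≤ difference 0 - difference 1
      first-terms = ≤-by (ρ 2 * ((Y - X) * (fromℕ 4 - Y + (fromℕ 4 - X))))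
        (0≤* (<⇒≤ (0<ρ 2)) (0≤* (≤⇒0≤- X≤Y) (0≤+ (≤⇒0≤- Y≤4) (≤⇒0≤- X≤4))))
        (trans (solve 3 (λ r Y X → r :* ((Y :- X) :* (♯ 4 :- Y :+ (♯ 4 :- X))) :=
            (Y :* ♯ 1 :- X :* ♯ 1) :* (♯ 12 :* r) :- (Y :* (Y :* ♯ 1) :- X :* (X :* ♯ 1)) :* r :- ♯ 4 :* r :*
                (Y :- X))
            refl (ρ 2) Y X)
          (+-congʳ (+-congʳ (*-congˡ (sym ρ₁≈12ρ₂)))))

    versine-mono-≤ : versine X̂ ≤ versine Ŷ
    versine-mono-≤ = 0≤-⇒≤ (≤-trans (0≤* (0≤* (0≤fromℕ 4) (<⇒≤ (0<ρ 2))) (≤⇒0≤- X≤Y)) versine-expansive)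

  -- π, arc cosines and spherical disks

  abstract
    versine-inverse : ∀ t → 0# ≤ t → t ≤ 1# → ∃[ X ] versine X ≈ t
    versine-inverse t 0≤t t≤1 = intermediate-value versine 0<1
      versine-mono-≤
      (λ X Y X≤Y → ≤-trans (≤-reflexive (*-identityˡ _)) (≤-trans (versine-lipschitz X Y X≤Y)
        (≤-by ((proj₁ Y - proj₁ X) * ρ 1) (0≤* (≤⇒0≤- X≤Y) (<⇒≤ (0<ρ 1)))
          (trans (solve 2 (λ d r → d :* r := d :* (♯ 2 :* r) :- d :* r) refl (proj₁ Y - proj₁ X) (ρ 1))
            (+-congʳ (trans (*-congˡ 2ρ₁≈1) (*-identityʳ _)))))))
      (λ ε 0<ε → slope * ε , *-positive 0<slope 0<ε , λ X Y X≤Y gY<gX+δ →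
        <-by (ε - (proj₁ Y - proj₁ X))
          (<⇒0<- (*-cancelˡ-< (<⇒≤ 0<slope) (≤-<-trans (versine-expansive X Y X≤Y)
            (<-by _ (<⇒0<- gY<gX+δ) (solve 3 (λ a b d → b :+ d :- a := d :- (a :- b))
                refl (versine Y) (versine X) _)))))
          (solve 3 (λ ε X Y → ε :- (Y :- X) := X :+ ε :- Y) refl ε (proj₁ X) (proj₁ Y)))
      zero-end four-end t ≤-refl ≤-refl
      (≤-trans (versine-upper-bound zero-end) (≤-resp-≈ (sym (zeroˡ (ρ 1))) refl 0≤t))
      -- At the right end the first two terms give 4 / 2 - 16 / 24 = 4 / 3, which exceeds 1 by 8
      -- `ρ 2`. This is why squares up to 4 suffice and π/2 is at most 2.
      (≤-trans t≤1 (≤-trans (≤-by (fromℕ 8 * ρ 2) (0≤* (0≤fromℕ 8) (<⇒≤ (0<ρ 2)))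
          (trans (solve 1 (λ r → ♯ 8 :* r := ♯ 4 :* (♯ 12 :* r) :- ♯ 4 :* ♯ 4 :* r :- ♯ 24 :* r) refl (ρ 2))
            (+-cong (+-congʳ (*-congˡ (sym ρ₁≈12ρ₂))) (-‿cong 24ρ₂≈1))))
        (versine-lower-bound four-end)))
      where
      slope : Carrier
      slope = fromℕ 4 * ρ 2
      0<slope : 0# < slope
      0<slope = *-positive (0<fromℕ-suc 3) (0<ρ 2)
      zero-end four-end : Domain
      zero-end = 0# , ≤-refl , 0≤fromℕ 4
      four-end = fromℕ 4 , 0≤fromℕ 4 , ≤-refl

    -- Only cosines in [0 , 1] are treated: π/2, the radius, and the distances from a disk's centre
    -- to the points exhibited in it all have nonnegative cosines.
    arccos : ∀ y → 0# ≤ y → y ≤ 1# → ∃[ θ ] 0# ≤ θ × θ ≤ fromℕ 2 × IsCos ℝ θ y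
    arccos y 0≤y y≤1 = from-root (versine-inverse (1# - y) (≤⇒0≤- y≤1)
        (≤-by y 0≤y (solve 1 (λ y → y := ♯ 1 :- (♯ 1 :- y)) refl y)))
      where
      from-root : ∃[ X ] versine X ≈ 1# - y → ∃[ θ ] 0# ≤ θ × θ ≤ fromℕ 2 × IsCos ℝ θ y
      from-root (X@(X₀ , 0≤X , X≤4) , versine≈) = from-sqrt (sqrt X₀ 0≤X X≤4)
        where
        y≈ : y ≈ - versine X + 1#
        y≈ = trans (solve 1 (λ y → y := :- (♯ 1 :- y) :+ ♯ 1) refl y) (+-congʳ (-‿cong (sym versine≈)))
        from-sqrt : ∃[ θ ] 0# ≤ θ × θ ≤ fromℕ 2 × θ * θ ≈ X₀ → ∃[ θ ] 0# ≤ θ × θ ≤ fromℕ 2 × IsCos ℝ θ y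
        from-sqrt (θ , 0≤θ , θ≤2 , θ²≈X) = θ , 0≤θ , θ≤2 , IsCos-versine X {θ} {y} θ²≈X y≈

  square : 0# ≤ x → x ≤ fromℕ 2 → Domain
  square {x} 0≤x x≤2 = x * x , 0≤x² x ,
    ≤-resp-≈ refl (solve 0 (♯ 2 :* ♯ 2 := ♯ 4) refl) (*-mono-≤ 0≤x (0≤fromℕ 2) x≤2 x≤2)

  module _ {θ φ a b : Carrier} (0≤θ : 0# ≤ θ) (φ≤2 : φ ≤ fromℕ 2) (cosθ : IsCos ℝ θ a) (cosφ : IsCos ℝ φ b) where

    private
      module _ (θ≤φ : θ ≤ φ) where
        0≤φ = ≤-trans 0≤θ θ≤φ
        X = square 0≤θ (≤-trans θ≤φ φ≤2)
        Y = square 0≤φ φ≤2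

        cos-difference : fromℕ 4 * ρ 2 * (φ * φ - θ * θ) ≤ a - b
        cos-difference = ≤-trans (versine-expansive X Y (*-mono-≤ 0≤θ 0≤φ θ≤φ θ≤φ))
          (≤-reflexive (trans (solve 2 (λ x y → y :- x := :- x :+ ♯ 1 :- (:- y :+ ♯ 1)) refl (versine X) (versine Y))
            (+-cong (sym (versine-IsCos X refl cosθ)) (-‿cong (sym (versine-IsCos Y refl cosφ))))))

    cos-antitone : θ ≤ φ → b ≤ a
    cos-antitone θ≤φ = 0≤-⇒≤ (≤-trans (0≤* (0≤* (0≤fromℕ 4) (<⇒≤ (0<ρ 2)))
      (≤⇒0≤- (*-mono-≤ 0≤θ (≤-trans 0≤θ θ≤φ) θ≤φ θ≤φ))) (cos-difference θ≤φ))

    cos-strictly-antitone : θ < φ → b < a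
    cos-strictly-antitone θ<φ = 0<-⇒< (<-≤-trans (*-positive (*-positive (0<fromℕ-suc 3) (0<ρ 2))
      (<-respʳ-≈ (solve 2 (λ x y → (y :- x) :* (y :+ x) := y :* y :- x :* x) refl θ φ)
        (*-positive (<⇒0<- θ<φ) (0<+ (≤-<-trans 0≤θ θ<φ) 0≤θ)))) (cos-difference (<⇒≤ θ<φ)))

  -- From 0 < 1 - cos θ ≤ θ² / 2.
  cos<1⇒0<θ : ∀ {θ a} → 0# ≤ θ → θ ≤ fromℕ 2 → IsCos ℝ θ a → a < 1# → 0# < θ
  cos<1⇒0<θ {θ} {a} 0≤θ θ≤2 cosθ a<1 = *-self-cancel-< ≤-refl 0≤θ (<-resp₂-≈ (sym (zeroˡ 0#)) refl
    (0<-cancel-* (<⇒≤ (0<ρ 1)) (<-≤-trans (<⇒0<- a<1) (begin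
      1# - a        ≈⟨ +-congˡ (-‿cong (versine-IsCos X refl cosθ)) ⟩
      1# - (- versine X + 1#)  ≈⟨ solve 1 (λ v → ♯ 1 :- (:- v :+ ♯ 1) := v) refl (versine X) ⟩
      versine X     ≤⟨ versine-upper-bound X ⟩
      θ * θ * ρ 1   ≈⟨ *-comm _ _ ⟩
      ρ 1 * (θ * θ) ∎))))
    where
    open ≤-Reasoning
    X = square 0≤θ θ≤2

  π/2 : Carrier
  π/2 = proj₁ (arccos 0# ≤-refl 0≤1)

  0≤π/2 : 0# ≤ π/2
  0≤π/2 = proj₁ (proj₂ (arccos 0# ≤-refl 0≤1))

  π/2≤2 : π/2 ≤ fromℕ 2
  π/2≤2 = proj₁ (proj₂ (proj₂ (arccos 0# ≤-refl 0≤1)))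

  cos[π/2]≈0 : IsCos ℝ π/2 0#
  cos[π/2]≈0 = proj₂ (proj₂ (proj₂ (arccos 0# ≤-refl 0≤1)))

  0<π/2 : 0# < π/2
  0<π/2 = cos<1⇒0<θ 0≤π/2 π/2≤2 cos[π/2]≈0 0<1

  π : Carrier
  π = π/2 + π/2

  -- Leastness is a negated strict inequality, so only zeros below π/2 have to be refuted, and these
  -- lie where the cosine is strictly decreasing.
  π-isPi : IsPi ℝ π
  π-isPi = π/2 , refl , 0<π/2 , cos[π/2]≈0 , λ x 0<x cosx≈0 x<π/2 →
    <-irrefl refl (cos-strictly-antitone (<⇒≤ 0<x) π/2≤2 cosx≈0 cos[π/2]≈0 x<π/2)

  π/2<π : π/2 < π
  π/2<π = x<x+ε 0<π/2

  cos≥0⇒θ≤π/2 : ∀ {θ a} → θ ≤ fromℕ 2 → IsCos ℝ θ a → 0# ≤ a → θ ≤ π/2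
  cos≥0⇒θ≤π/2 θ≤2 cosθ 0≤a π/2<θ = 0≤a (cos-strictly-antitone 0≤π/2 θ≤2 cos[π/2]≈0 cosθ π/2<θ)

  -- Scalar products of unit vectors

  Vec³ : Set
  Vec³ = Vector Carrier 3

  infix 8 _∙_

  _∙_ : Vec³ → Vec³ → Carrier
  _∙_ = dot ℝ

  dot-comm : ∀ v w → v ∙ w ≈ w ∙ v
  dot-comm v w = +-cong (*-comm _ _) (+-cong (*-comm _ _) (+-congʳ (*-comm _ _)))

  dot-nonnegative : ∀ v → 0# ≤ v ∙ v
  dot-nonnegative v = 0≤+ (0≤x² _) (0≤+ (0≤x² _) (0≤+ (0≤x² _) ≤-refl))

  combination : (a b c : Carrier) (u v w : Vec³) → Vec³
  combination a b c u v w i = a * u i + b * v i + c * w i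

  dot-combinationˡ : ∀ a b c u v w x → combination a b c u v w ∙ x ≈ a * (u ∙ x) + b * (v ∙ x) + c * (w ∙ x)
  dot-combinationˡ a b c u v w x = begin
    sum (λ i → (a * u i + b * v i + c * w i) * x i)
      ≈⟨ sum-cong-≋ {x = λ i → (a * u i + b * v i + c * w i) * x i}
           {y = λ i → a * (u i * x i) + b * (v i * x i) + c * (w i * x i)} (λ i → trans (distribʳ _ _ _)
           (+-cong (trans (distribʳ _ _ _) (+-cong (*-assoc _ _ _) (*-assoc _ _ _))) (*-assoc _ _ _))) ⟩
    sum (λ i → a * (u i * x i) + b * (v i * x i) + c * (w i * x i))
      ≈⟨ ∑-distrib-+ (λ i → a * (u i * x i) + b * (v i * x i)) (λ i → c * (w i * x i)) ⟩
    sum (λ i → a * (u i * x i) + b * (v i * x i)) + sum (λ i → c * (w i * x i))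
      ≈⟨ +-congʳ (∑-distrib-+ (λ i → a * (u i * x i)) (λ i → b * (v i * x i))) ⟩
    sum (λ i → a * (u i * x i)) + sum (λ i → b * (v i * x i)) + sum (λ i → c * (w i * x i))
      ≈⟨ +-cong (+-cong (*-distribˡ-sum a (λ i → u i * x i)) (*-distribˡ-sum b
          (λ i → v i * x i))) (*-distribˡ-sum c (λ i → w i * x i)) ⟨
    a * (u ∙ x) + b * (v ∙ x) + c * (w ∙ x) ∎
    where open Relation.Binary.Reasoning.Setoid setoid

  dot-combinationʳ : ∀ a b c u v w x → x ∙ combination a b c u v w ≈ a * (x ∙ u) + b * (x ∙ v) + c * (x ∙ w)
  dot-combinationʳ a b c u v w x = trans (dot-comm x (combination a b c u v w)) (trans
      (dot-combinationˡ a b c u v w x)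
    (+-cong (+-cong (*-congˡ (dot-comm u x)) (*-congˡ (dot-comm v x))) (*-congˡ (dot-comm w x))))

  module _ (û v̂ ŵ : 𝕊² ℝ) where
    private
      u v w : Vec³
      u = proj₁ û
      v = proj₁ v̂
      w = proj₁ ŵ
      u²≈1 : u ∙ u ≈ 1#
      u²≈1 = proj₂ û
      v²≈1 : v ∙ v ≈ 1#
      v²≈1 = proj₂ v̂
      w²≈1 : w ∙ w ≈ 1#
      w²≈1 = proj₂ ŵ

    -- The quadratic form of the Gram matrix. It reduces the geometry below to polynomials in scalar
    -- products, without coordinates.
    dot-combination : ∀ a b c → combination a b c u v w ∙ combination a b c u v w ≈
      a * (a * 1# + b * (u ∙ v) + c * (u ∙ w)) + b * (a * (u ∙ v) + b * 1# + c * (v ∙ w)) +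
      c * (a * (u ∙ w) + b * (v ∙ w) + c * 1#)
    dot-combination a b c = trans (dot-combinationˡ a b c u v w s)
      (+-cong (+-cong
        (*-congˡ (trans (dot-combinationʳ a b c u v w u) (+-congʳ (+-congʳ (*-congˡ u²≈1)))))
        (*-congˡ (trans (dot-combinationʳ a b c u v w v) (+-congʳ (+-cong (*-congˡ (dot-comm v u)) (*-congˡ v²≈1))))))
        (*-congˡ (trans (dot-combinationʳ a b c u v w w) (+-cong (+-cong (*-congˡ (dot-comm w u)) (*-congˡ
            (dot-comm w v))) (*-congˡ w²≈1)))))
      where s = combination a b c u v w

    -- 0 ≤ ∣v + w - (u ∙ v + u ∙ w) u∣²
    bessel : (u ∙ v + u ∙ w) * (u ∙ v + u ∙ w) ≤ fromℕ 2 * (1# + v ∙ w)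
    bessel = ≤-by _ (dot-nonnegative (combination (- (u ∙ v + u ∙ w)) 1# 1# u v w))
      (trans (dot-combination (- (u ∙ v + u ∙ w)) 1# 1#)
        (solve 3 (λ p q m → let k = :- (p :+ q) ; l = ♯ 1 in
          k :* (k :* ♯ 1 :+ l :* p :+ l :* q) :+ l :* (k :* p :+ l :* ♯ 1 :+ l :* m) :+ l :*
              (k :* q :+ l :* m :+ l :* ♯ 1)
          := ♯ 2 :* (♯ 1 :+ m) :- (p :+ q) :* (p :+ q)) refl (u ∙ v) (u ∙ w) (v ∙ w)))

  -- From 0 ≤ ∣v - w∣² = 2 - 2 v ∙ w; the coefficient 0 fills the first of the three places of
  -- `combination`.
  dot≤1 : ∀ ((v , _) (w , _) : 𝕊² ℝ) → v ∙ w ≤ 1#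
  dot≤1 v̂@(v , _) ŵ@(w , _) = *-cancelˡ-≤ (0<fromℕ-suc 1) (≤-by _ (dot-nonnegative (combination 0# 1# (- 1#) v v w))
    (trans (dot-combination v̂ v̂ ŵ 0# 1# (- 1#))
      (solve 2 (λ p m → let z = ♯ 0 ; l = ♯ 1 ; k = :- ♯ 1 in
        z :* (z :* ♯ 1 :+ l :* p :+ k :* m) :+ l :* (z :* p :+ l :* ♯ 1 :+ k :* m) :+ k :*
            (z :* m :+ l :* m :+ k :* ♯ 1)
        := ♯ 2 :* ♯ 1 :- ♯ 2 :* m) refl (v ∙ v) (v ∙ w))))

  -- u = (v + w) / 2s, where s is the cosine of half the angle between v and w.
  module _ (v̂ ŵ : 𝕊² ℝ) {s s⁻¹ : Carrier}
    (s²≈[1+v∙w]/2 : s * s ≈ half * (1# + proj₁ v̂ ∙ proj₁ ŵ)) (ss⁻¹≈1 : s * s⁻¹ ≈ 1#) where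

    private
      v w : Vec³
      v = proj₁ v̂
      w = proj₁ ŵ
      v²≈1 : v ∙ v ≈ 1#
      v²≈1 = proj₂ v̂
      w²≈1 : w ∙ w ≈ 1#
      w²≈1 = proj₂ ŵ

      a m : Carrier
      a = half * s⁻¹
      m = v ∙ w
      u : Vec³
      u = combination 0# a a v v w

      a[1+m]≈s : a * (1# + m) ≈ s
      a[1+m]≈s = begin
        half * s⁻¹ * (1# + m)    ≈⟨ solve 3 (λ h i x → h :* i :* x := h :* x :* i) refl half s⁻¹ (1# + m) ⟩
        half * (1# + m) * s⁻¹    ≈⟨ *-congʳ s²≈[1+v∙w]/2 ⟨
        s * s * s⁻¹              ≈⟨ *-assoc _ _ _ ⟩
        s * (s * s⁻¹)            ≈⟨ *-congˡ ss⁻¹≈1 ⟩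
        s * 1#                   ≈⟨ *-identityʳ s ⟩
        s                        ∎
        where open Relation.Binary.Reasoning.Setoid setoid

      u²≈1 : u ∙ u ≈ 1#
      u²≈1 = begin
        u ∙ u                          ≈⟨ dot-combination v̂ v̂ ŵ 0# a a ⟩
        _                              ≈⟨ solve 3 (λ a p m → ♯ 0 :* (♯ 0 :* ♯ 1 :+ a :* p :+ a :* m) :+
                                            a :* (♯ 0 :* p :+ a :* ♯ 1 :+ a :* m) :+ a :*
                                                (♯ 0 :* m :+ a :* m :+ a :* ♯ 1)
                                            := (a :+ a) :* (a :* (♯ 1 :+ m))) refl a (v ∙ v) m ⟩
        (a + a) * (a * (1# + m))       ≈⟨ *-cong (half*x+half*x≈x s⁻¹) a[1+m]≈s ⟩
        s⁻¹ * s                        ≈⟨ *-comm s⁻¹ s ⟩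
        s * s⁻¹                        ≈⟨ ss⁻¹≈1 ⟩
        1#                             ∎
        where open Relation.Binary.Reasoning.Setoid setoid

    midpoint : 𝕊² ℝ
    midpoint = u , u²≈1

    midpoint-dotˡ : u ∙ v ≈ s
    midpoint-dotˡ = trans (dot-combinationˡ 0# a a v v w v) (trans (+-cong (+-cong (*-congˡ v²≈1) (*-congˡ v²≈1))
        (*-congˡ (dot-comm w v)))
      (trans (solve 2 (λ a m → ♯ 0 :* ♯ 1 :+ a :* ♯ 1 :+ a :* m := a :* (♯ 1 :+ m)) refl a m) a[1+m]≈s))

    midpoint-dotʳ : u ∙ w ≈ s
    midpoint-dotʳ = trans (dot-combinationˡ 0# a a v v w w) (trans (+-congˡ (*-congˡ w²≈1))
      (trans (solve 2 (λ a m → ♯ 0 :* m :+ a :* m :+ a :* ♯ 1 := a :* (♯ 1 :+ m)) refl a m) a[1+m]≈s))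

  IsCos-resp-≈ : ∀ {θ a b} → a ≈ b → IsCos ℝ θ a → IsCos ℝ θ b
  IsCos-resp-≈ a≈b cosθ = ⟶-cong cosθ (λ _ → refl) a≈b

  -- Intersection of spherical disks whose radius has cosine c

  module _ {c : Carrier} (0<c : 0# < c) (c<1 : c < 1#) where

    radius : Carrier
    radius = proj₁ (arccos c (<⇒≤ 0<c) (<⇒≤ c<1))

    0≤radius : 0# ≤ radius
    0≤radius = proj₁ (proj₂ (arccos c (<⇒≤ 0<c) (<⇒≤ c<1)))

    radius≤2 : radius ≤ fromℕ 2
    radius≤2 = proj₁ (proj₂ (proj₂ (arccos c (<⇒≤ 0<c) (<⇒≤ c<1))))

    cos-radius : IsCos ℝ radius c
    cos-radius = proj₂ (proj₂ (proj₂ (arccos c (<⇒≤ 0<c) (<⇒≤ c<1))))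

    0<radius : 0# < radius
    0<radius = cos<1⇒0<θ 0≤radius radius≤2 cos-radius c<1

    radius<π : radius < π
    radius<π = ≤-<-trans (cos≥0⇒θ≤π/2 radius≤2 cos-radius (<⇒≤ 0<c)) π/2<π

    c≤dot⇒∈disk : ∀ {s} (v̂@(v , _) û@(u , _) : 𝕊² ℝ) → u ∙ v ≈ s → c ≤ s → s ≤ 1# → sphericalDisk ℝ π radius v̂ û
    c≤dot⇒∈disk {s} v̂ û u∙v≈s c≤s s≤1 =
      let 0≤s = ≤-trans (<⇒≤ 0<c) c≤s
          θ , 0≤θ , θ≤2 , cosθ≈s = arccos s 0≤s s≤1
      in  θ , (0≤θ , ≤-trans (cos≥0⇒θ≤π/2 θ≤2 cosθ≈s 0≤s) (<⇒≤ π/2<π) , IsCos-resp-≈ (sym u∙v≈s) cosθ≈s) ,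
          λ r<θ → c≤s (cos-strictly-antitone 0≤radius θ≤2 cos-radius cosθ≈s r<θ)

    ∈disk⇒c≤dot : ∀ (v̂@(v , _) û@(u , _) : 𝕊² ℝ) → sphericalDisk ℝ π radius v̂ û → c ≤ u ∙ v
    ∈disk⇒c≤dot v̂ û (θ , (0≤θ , _ , cosθ≈u∙v) , θ≤r) = cos-antitone 0≤θ radius≤2 cosθ≈u∙v cos-radius θ≤r

    -- The midpoint of v and w lies in both disks: t is the squared cosine of half their angle, and
    -- t ≥ c² > 0 makes s = √t invertible, so that the midpoint exists.
    close⇒disks-meet : ∀ (v̂@(v , _) ŵ@(w , _) : 𝕊² ℝ) → fromℕ 2 * (c * c) ≤ 1# + v ∙ w →
      sphericalDisk ℝ π radius v̂ ≬ sphericalDisk ℝ π radius ŵ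
    close⇒disks-meet v̂@(v , _) ŵ@(w , _) 2c²≤1+m =
      from-sqrt (sqrt t (<⇒≤ 0<t) (≤-trans t≤1 (≤-by (fromℕ 3) (0≤fromℕ 3) (solve 0 (♯ 3 := ♯ 4 :- ♯ 1) refl))))
      where
      m t : Carrier
      m = v ∙ w
      t = half * (1# + m)
      2t≈1+m : fromℕ 2 * t ≈ 1# + m
      2t≈1+m = trans (solve 1 (λ t → ♯ 2 :* t := t :+ t) refl t) (half*x+half*x≈x (1# + m))
      c²≤t : c * c ≤ t
      c²≤t = *-cancelˡ-≤ (0<fromℕ-suc 1) (≤-resp-≈ refl (sym 2t≈1+m) 2c²≤1+m)
      t≤1 : t ≤ 1#
      t≤1 = *-cancelˡ-≤ (0<fromℕ-suc 1) (≤-resp-≈ (sym 2t≈1+m)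
        (solve 0 (♯ 1 :+ ♯ 1 := ♯ 2 :* ♯ 1) refl) (+-mono-≤ ≤-refl (dot≤1 v̂ ŵ)))
      0<t : 0# < t
      0<t = <-≤-trans (*-positive 0<c 0<c) c²≤t
      from-sqrt : ∃[ s ] 0# ≤ s × s ≤ fromℕ 2 × s * s ≈ t → sphericalDisk ℝ π radius v̂ ≬ sphericalDisk ℝ π radius ŵ
      from-sqrt (s , 0≤s , _ , s²≈t) = midpoint v̂ ŵ s²≈t ss⁻¹≈1 ,
        c≤dot⇒∈disk v̂ (midpoint v̂ ŵ s²≈t ss⁻¹≈1) (midpoint-dotˡ v̂ ŵ s²≈t ss⁻¹≈1) c≤s s≤1 ,
        c≤dot⇒∈disk ŵ (midpoint v̂ ŵ s²≈t ss⁻¹≈1) (midpoint-dotʳ v̂ ŵ s²≈t ss⁻¹≈1) c≤s s≤1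
        where
        c≤s : c ≤ s
        c≤s = *-self-cancel-≤ 0≤s (≤-resp-≈ refl (sym s²≈t) c²≤t)
        s≤1 : s ≤ 1#
        s≤1 = *-self-cancel-≤ 0≤1 (≤-resp-≈ (sym s²≈t) (sym (*-identityˡ 1#)) t≤1)
        ss⁻¹≈1 : s * proj₁ (0<⇒invertible (<-≤-trans 0<c c≤s)) ≈ 1#
        ss⁻¹≈1 = proj₂ (proj₂ (0<⇒invertible (<-≤-trans 0<c c≤s)))

    -- `bessel` takes the place of the triangle inequality for angles: a common point u gives (2c)²
    -- ≤ (u ∙ v + u ∙ w)² ≤ 2 (1 + v ∙ w).
    disks-meet⇒close : ∀ (v̂@(v , _) ŵ@(w , _) : 𝕊² ℝ) → sphericalDisk ℝ π radius v̂ ≬ sphericalDisk ℝ π radius ŵ →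
      fromℕ 2 * (c * c) ≤ 1# + v ∙ w
    disks-meet⇒close v̂@(v , _) ŵ@(w , _) (û@(u , _) , u∈v , u∈w) = *-cancelˡ-≤ (0<fromℕ-suc 1) (begin
      fromℕ 2 * (fromℕ 2 * (c * c))  ≈⟨ solve 1 (λ c → ♯ 2 :* (♯ 2 :* (c :* c)) := (c :+ c) :* (c :+ c)) refl c ⟩
      (c + c) * (c + c)              ≤⟨ *-mono-≤ 0≤2c (≤-trans 0≤2c 2c≤) 2c≤ 2c≤ ⟩
      (u ∙ v + u ∙ w) * (u ∙ v + u ∙ w) ≤⟨ bessel û v̂ ŵ ⟩
      fromℕ 2 * (1# + v ∙ w)         ∎)
      where
      open ≤-Reasoning
      0≤2c = 0≤+ (<⇒≤ 0<c) (<⇒≤ 0<c)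
      2c≤ = +-mono-≤ (∈disk⇒c≤dot v̂ û u∈v) (∈disk⇒c≤dot ŵ û u∈w)

  -- Points on the equator

  parity : ∀ d → ∃[ e ] (d ≡ 2 ℕ.* e ⊎ d ≡ suc (2 ℕ.* e))
  parity zero    = 0 , inj₁ ≡.refl
  parity (suc d) = increment (parity d)
    where
    increment : ∃[ e ] (d ≡ 2 ℕ.* e ⊎ d ≡ suc (2 ℕ.* e)) → ∃[ e ] (suc d ≡ 2 ℕ.* e ⊎ suc d ≡ suc (2 ℕ.* e))
    increment (e , inj₁ d≡2e)   = e , inj₂ (≡.cong suc d≡2e)
    increment (e , inj₂ d≡1+2e) = suc e , inj₁ (≡.trans (≡.cong suc d≡1+2e) (≡.sym (ℕ.*-suc 2 e)))

  σ : ℕ → Carrier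
  σ a = (- 1#) ^ a

  σ² : ∀ a → σ a * σ a ≈ 1#
  σ² zero    = *-identityˡ 1#
  σ² (suc a) = trans (solve 1 (λ s → (:- ♯ 1 :* s) :* (:- ♯ 1 :* s) := s :* s) refl (σ a)) (σ² a)

  σσ : ∀ a d → σ a * σ (a ℕ.+ d) ≈ σ d
  σσ a d = trans (*-congˡ (^-homo-* (- 1#) a d))
    (trans (sym (*-assoc _ _ _)) (trans (*-congʳ (σ² a)) (*-identityˡ _)))

  σ-even : ∀ e → σ (2 ℕ.* e) ≈ 1#
  σ-even e = trans (^-homo-* (- 1#) e (e ℕ.+ 0)) (trans (*-congˡ (reflexive (≡.cong σ (ℕ.+-identityʳ e)))) (σ² e))

  σ-odd : ∀ e → σ (suc (2 ℕ.* e)) ≈ - 1#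
  σ-odd e = trans (*-congˡ (σ-even e)) (*-identityʳ _)

  module Centres (n : ℕ) (3≤n : 3 ℕ.≤ n) where

    N : Carrier
    N = fromℕ n

    3≤N : fromℕ 3 ≤ N
    3≤N = fromℕ-mono-≤ 3≤n

    0<N : 0# < N
    0<N = <-≤-trans (0<fromℕ-suc 2) 3≤N

    0<N² : 0# < N * N
    0<N² = *-positive 0<N 0<N

    abstract
      N⁻¹ : Carrier
      N⁻¹ = proj₁ (0<⇒invertible 0<N)

      0<N⁻¹ : 0# < N⁻¹
      0<N⁻¹ = proj₁ (proj₂ (0<⇒invertible 0<N))

      NN⁻¹≈1 : N * N⁻¹ ≈ 1#
      NN⁻¹≈1 = proj₂ (proj₂ (0<⇒invertible 0<N))

    c : Carrier
    c = fromℕ 2 * N⁻¹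

    Nc≈2 : N * c ≈ fromℕ 2
    Nc≈2 = trans (solve 2 (λ N i → N :* (♯ 2 :* i) := ♯ 2 :* (N :* i))
        refl N N⁻¹) (trans (*-congˡ NN⁻¹≈1) (*-identityʳ _))

    0<c : 0# < c
    0<c = *-positive (0<fromℕ-suc 1) 0<N⁻¹

    c<1 : c < 1#
    c<1 = *-cancelˡ-< (<⇒≤ 0<N) (<-resp₂-≈ (sym Nc≈2) (sym (*-identityʳ N)) (<-≤-trans (fromℕ-mono-<
        (ℕ.n<1+n 2)) 3≤N))

    -- Makes the disk at a pole meet every disk on the equator. For n = 3 the left side is 8 / 9.
    2c²≤1 : fromℕ 2 * (c * c) ≤ 1#
    2c²≤1 = *-cancelˡ-≤ 0<N² (begin
      N * N * (fromℕ 2 * (c * c))      ≈⟨ solve 2 (λ N c → N :* N :* (♯ 2 :* (c :* c))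
          := ♯ 2 :* ((N :* c) :* (N :* c))) refl N c ⟩
      fromℕ 2 * ((N * c) * (N * c))    ≈⟨ *-congˡ (*-cong Nc≈2 Nc≈2) ⟩
      fromℕ 2 * (fromℕ 2 * fromℕ 2)    ≈⟨ solve 0 (♯ 2 :* (♯ 2 :* ♯ 2) := ♯ 8) refl ⟩
      fromℕ 8                          ≤⟨ fromℕ-mono-≤ (ℕ.n≤1+n 8) ⟩
      fromℕ 9                          ≈⟨ solve 0 (♯ 9 := ♯ 3 :* ♯ 3) refl ⟩
      fromℕ 3 * fromℕ 3                ≤⟨ *-mono-≤ (0≤fromℕ 3) (<⇒≤ 0<N) 3≤N 3≤N ⟩
      N * N                            ≈⟨ *-identityʳ _ ⟨
      N * N * 1#                       ∎)
      where open ≤-Reasoning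

    p : ℕ → Carrier
    p a = fromℕ 2 * fromℕ a - N

    P : ℕ → Carrier
    P a = N * N + p a * p a

    0<P : ∀ a → 0# < P a
    0<P a = 0<+ 0<N² (0≤x² (p a))

    abstract
      P⁻¹ : ℕ → Carrier
      P⁻¹ a = proj₁ (0<⇒invertible (0<P a))

      PP⁻¹≈1 : ∀ a → P a * P⁻¹ a ≈ 1#
      PP⁻¹≈1 a = proj₂ (proj₂ (0<⇒invertible (0<P a)))

    -- (-1)ᵃ ((1 - t²) / (1 + t²) , 2t / (1 + t²) , 0) for t = p a / N = (2a - n) / n.
    equatorial : ℕ → Vec³
    equatorial a 0F = σ a * P⁻¹ a * (N * N - p a * p a)
    equatorial a 1F = σ a * P⁻¹ a * (fromℕ 2 * p a * N)
    equatorial a 2F = 0#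

    -- P a * P b times the scalar product of the points without their signs.
    M : ℕ → ℕ → Carrier
    M a b = (N * N - p a * p a) * (N * N - p b * p b) + fromℕ 2 * p a * N * (fromℕ 2 * p b * N)

    PP*dot : ∀ a b → P a * P b * (equatorial a ∙ equatorial b) ≈ σ a * σ b * M a b
    PP*dot a b = begin
      P a * P b * (equatorial a ∙ equatorial b)
        ≈⟨ *-congˡ (solve 6 (λ u v x x′ y y′ → u :* x :* (v :* x′) :+ (u :* y :* (v :* y′) :+
            (♯ 0 :* ♯ 0 :+ ♯ 0)) := u :* v :* (x :* x′ :+ y :* y′))
             refl (σ a * P⁻¹ a) (σ b * P⁻¹ b) (N * N - p a * p a) (N * N - p b * p b) (fromℕ 2 * p a * N)
                 (fromℕ 2 * p b * N)) ⟩
      P a * P b * (σ a * P⁻¹ a * (σ b * P⁻¹ b) * M a b)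
        ≈⟨ *-assoc _ _ _ ⟨
      P a * P b * (σ a * P⁻¹ a * (σ b * P⁻¹ b)) * M a b
        ≈⟨ *-congʳ (solve 6 (λ P Q s i t j → P :* Q :* (s :* i :* (t :* j)) := P :* i :* (Q :* j) :* (s :* t))
            refl (P a) (P b) (σ a) (P⁻¹ a) (σ b) (P⁻¹ b)) ⟩
      P a * P⁻¹ a * (P b * P⁻¹ b) * (σ a * σ b) * M a b
        ≈⟨ *-congʳ (*-congʳ (*-cong (PP⁻¹≈1 a) (PP⁻¹≈1 b))) ⟩
      1# * 1# * (σ a * σ b) * M a b
        ≈⟨ solve 2 (λ s m → ♯ 1 :* ♯ 1 :* s :* m := s :* m) refl (σ a * σ b) (M a b) ⟩
      σ a * σ b * M a b ∎
      where open Relation.Binary.Reasoning.Setoid setoid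

    equatorial-unit : ∀ a → equatorial a ∙ equatorial a ≈ 1#
    equatorial-unit a = ≤-antisym (*-cancelˡ-≤ 0<PP (≤-reflexive eq)) (*-cancelˡ-≤ 0<PP (≤-reflexive (sym eq)))
      where
      0<PP = *-positive (0<P a) (0<P a)
      eq : P a * P a * (equatorial a ∙ equatorial a) ≈ P a * P a * 1#
      eq = trans (PP*dot a a) (trans (*-congʳ (σ² a))
        (solve 2 (λ N p → ♯ 1 :* ((N :* N :- p :* p) :* (N :* N :- p :* p) :+ ♯ 2 :* p :* N :* (♯ 2 :* p :* N))
          := (N :* N :+ p :* p) :* (N :* N :+ p :* p) :* ♯ 1) refl N (p a)))

    centre : ℕ → 𝕊² ℝ
    centre a = equatorial a , equatorial-unit a

    Close Far : Vec³ → Vec³ → Set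
    Close v w = fromℕ 2 * (c * c) ≤ 1# + v ∙ w
    Far v w = 1# + v ∙ w < fromℕ 2 * (c * c)

    module _ (a b : ℕ) {S : Carrier} (PP[1+dot]≈2S : P a * P b *
        (1# + equatorial a ∙ equatorial b) ≈ fromℕ 2 * S) where
      private
        -- Clears all denominators: N² turns c² into 4, and P a P b turns 1 + v ∙ w into the
        -- polynomial 2 S.
        scale = N * N * (P a * P b)
        0<scale : 0# < scale
        0<scale = *-positive 0<N² (*-positive (0<P a) (0<P b))
        scaled-left : scale * (fromℕ 2 * (c * c)) ≈ fromℕ 2 * (fromℕ 4 * (P a * P b))
        scaled-left = trans (solve 3 (λ N c P → N :* N :* P :* (♯ 2 :* (c :* c))
            := ♯ 2 :* ((N :* c) :* (N :* c) :* P)) refl N c (P a * P b))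
          (*-congˡ (*-congʳ (trans (*-cong Nc≈2 Nc≈2) (solve 0 (♯ 2 :* ♯ 2 := ♯ 4) refl))))
        scaled-right : scale * (1# + equatorial a ∙ equatorial b) ≈ fromℕ 2 * (N * N * S)
        scaled-right = trans (*-assoc _ _ _) (trans (*-congˡ PP[1+dot]≈2S)
          (solve 2 (λ n S → n :* (♯ 2 :* S) := ♯ 2 :* (n :* S)) refl (N * N) S))

      close : fromℕ 4 * (P a * P b) ≤ N * N * S → Close (equatorial a) (equatorial b)
      close 4PP≤ = *-cancelˡ-≤ 0<scale (≤-resp-≈ (sym scaled-left) (sym scaled-right) (*-monoˡ-≤ (0≤fromℕ 2) 4PP≤))

      far : N * N * S < fromℕ 4 * (P a * P b) → Far (equatorial a) (equatorial b)
      far <4PP = *-cancelˡ-< (<⇒≤ 0<scale) (<-resp₂-≈ (sym scaled-right) (sym scaled-left) (*-monoˡ-<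
          (0<fromℕ-suc 1) <4PP))

    PP[1+dot] : ∀ a d {ε} → σ d ≈ ε →
      P a * P (a ℕ.+ d) * (1# + equatorial a ∙ equatorial (a ℕ.+ d)) ≈ P a * P (a ℕ.+ d) + ε * M a (a ℕ.+ d)
    PP[1+dot] a d σd≈ε = trans (distribˡ _ _ _) (+-cong (*-identityʳ _)
      (trans (PP*dot a (a ℕ.+ d)) (*-congʳ (trans (σσ a d) σd≈ε))))

    -- This is 1 + cos δ = 2 (cos (δ/2))². For the angle δ between the unsigned points, N² + p q and
    -- N (q - p) are the cosine and the sine of δ/2, up to the common factor √(P a P b).
    PP[1+dot]-even : ∀ a d → σ d ≈ 1# →
      P a * P (a ℕ.+ d) * (1# + equatorial a ∙ equatorial (a ℕ.+ d)) ≈ fromℕ 2 * ((N * N + p a * p (a ℕ.+ d)) *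
          (N * N + p a * p (a ℕ.+ d)))
    PP[1+dot]-even a d σd≈1 = trans (PP[1+dot] a d σd≈1)
      (solve 3 (λ N p q → (N :* N :+ p :* p) :* (N :* N :+ q :* q) :+
          ♯ 1 :* ((N :* N :- p :* p) :* (N :* N :- q :* q) :+ ♯ 2 :* p :* N :* (♯ 2 :* q :* N))
          := ♯ 2 :* ((N :* N :+ p :* q) :* (N :* N :+ p :* q))) refl N (p a) (p (a ℕ.+ d)))

    -- The signs now differ, so this is 1 - cos δ = 2 (sin (δ/2))², with q - p = 2 d.
    PP[1+dot]-odd : ∀ a d → σ d ≈ - 1# →
      P a * P (a ℕ.+ d) * (1# + equatorial a ∙ equatorial (a ℕ.+ d)) ≈ fromℕ 2 * (fromℕ 4 * (N * N) *
          (fromℕ d * fromℕ d))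
    PP[1+dot]-odd a d σd≈-1 = trans (PP[1+dot] a d σd≈-1)
      (trans (solve 3 (λ N p q → (N :* N :+ p :* p) :* (N :* N :+ q :* q) :+
          :- ♯ 1 :* ((N :* N :- p :* p) :* (N :* N :- q :* q) :+ ♯ 2 :* p :* N :* (♯ 2 :* q :* N))
          := ♯ 2 :* (N :* N :* ((q :- p) :* (q :- p)))) refl N (p a) (p (a ℕ.+ d)))
      (trans (*-congˡ (*-congˡ (*-cong q-p≈2d q-p≈2d)))
        (solve 2 (λ n d → ♯ 2 :* (n :* (♯ 2 :* d :* (♯ 2 :* d))) := ♯ 2 :* (♯ 4 :* n :* (d :* d)))
            refl (N * N) (fromℕ d))))
      where
      q-p≈2d : p (a ℕ.+ d) - p a ≈ fromℕ 2 * fromℕ d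
      q-p≈2d = trans (+-congʳ (+-congʳ (*-congˡ (fromℕ-+ a d))))
        (solve 3 (λ a d N → ♯ 2 :* (a :+ d) :- N :- (♯ 2 :* a :- N) := ♯ 2 :* d) refl (fromℕ a) (fromℕ d) N)

    P≤2N² : ∀ a → a ℕ.≤ n → P a ≤ fromℕ 2 * (N * N)
    P≤2N² a a≤n = ≤-by (fromℕ 4 * (fromℕ a * (N - fromℕ a))) (0≤* (0≤fromℕ 4) (0≤* (0≤fromℕ a) (≤⇒0≤-
        (fromℕ-mono-≤ a≤n))))
      (solve 2 (λ a N → ♯ 4 :* (a :* (N :- a))
          := ♯ 2 :* (N :* N) :- (N :* N :+ (♯ 2 :* a :- N) :* (♯ 2 :* a :- N))) refl (fromℕ a) N)

    4PP≤16N⁴ : ∀ a b → a ℕ.≤ n → b ℕ.≤ n → fromℕ 4 * (P a * P b) ≤ N * N * (fromℕ 16 * (N * N))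
    4PP≤16N⁴ a b a≤n b≤n = ≤-resp-≈ refl
      (solve 1 (λ n → ♯ 4 :* (♯ 2 :* n :* (♯ 2 :* n)) := n :* (♯ 16 :* n)) refl (N * N))
      (*-monoˡ-≤ (0≤fromℕ 4) (*-mono-≤ (<⇒≤ (0<P a)) (0≤* (0≤fromℕ 2) (<⇒≤ 0<N²)) (P≤2N² a a≤n) (P≤2N² b b≤n)))

    close-odd : ∀ a d → a ℕ.+ d ℕ.≤ n → σ d ≈ - 1# → 2 ℕ.≤ d → Close (equatorial a) (equatorial (a ℕ.+ d))
    close-odd a d a+d≤n σd≈-1 2≤d = close a (a ℕ.+ d) (PP[1+dot]-odd a d σd≈-1)
      (≤-trans (4PP≤16N⁴ a (a ℕ.+ d) (ℕ.≤-trans (ℕ.m≤m+n a d) a+d≤n) a+d≤n) (*-monoˡ-≤ (<⇒≤ 0<N²) (begin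
        fromℕ 16 * (N * N)                     ≈⟨ solve 1 (λ n → ♯ 16 :* n := ♯ 4 :* n :* (♯ 2 :* ♯ 2)) refl (N * N) ⟩
        fromℕ 4 * (N * N) * (fromℕ 2 * fromℕ 2) ≤⟨ *-monoˡ-≤ (0≤* (0≤fromℕ 4) (<⇒≤ 0<N²)) (*-mono-≤ (0≤fromℕ 2)
            (0≤fromℕ d) 2≤D 2≤D) ⟩
        fromℕ 4 * (N * N) * (fromℕ d * fromℕ d) ∎)))
      where
      open ≤-Reasoning
      2≤D = fromℕ-mono-≤ 2≤d

    -- With p = p a, what is needed is P a P (a + 1) > N⁴, that is, p and q not both zero. Since
    -- they differ by 2, 2 (p² + q²) = 4 + (p + q)² is positive.
    far-successor : ∀ a → Far (equatorial a) (equatorial (a ℕ.+ 1))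
    far-successor a = far a (a ℕ.+ 1) (PP[1+dot]-odd a 1 (σ-odd 0)) (*-cancelˡ-< (0≤fromℕ 2) (<-by
        (fromℕ 4 * (N * N * (fromℕ 4 + (p a + q) * (p a + q)) + fromℕ 2 * ((p a * q) * (p a * q))))
        (*-positive (0<fromℕ-suc 3) (0<+ (*-positive 0<N² (0<+ (0<fromℕ-suc 3) (0≤x² (p a + q)))) (0≤* (0≤fromℕ 2)
            (0≤x² (p a * q)))))
        (trans (*-congˡ (+-congʳ (*-congˡ (+-congʳ 4≈))))
          (solve 3 (λ N p q → ♯ 4 :* (N :* N :* ((q :- p) :* (q :- p) :+ (p :+ q) :* (p :+ q)) :+ ♯ 2 :*
              (p :* q :* (p :* q)))
            := ♯ 2 :* (♯ 4 :* ((N :* N :+ p :* p) :* (N :* N :+ q :* q))) :- ♯ 2 :* (N :* N :* (♯ 4 :* (N :* N) :*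
                ((♯ 1 :+ ♯ 0) :* (♯ 1 :+ ♯ 0)))))
            refl N (p a) q))))
      where
      q = p (a ℕ.+ 1)
      q-p≈2 : q - p a ≈ fromℕ 2
      q-p≈2 = trans (+-congʳ (+-congʳ (*-congˡ (fromℕ-+ a 1))))
        (solve 2 (λ a N → ♯ 2 :* (a :+ (♯ 1 :+ ♯ 0)) :- N :- (♯ 2 :* a :- N) := ♯ 2) refl (fromℕ a) N)
      4≈ : fromℕ 4 ≈ (q - p a) * (q - p a)
      4≈ = trans (solve 0 (♯ 4 := ♯ 2 :* ♯ 2) refl) (sym (*-cong q-p≈2 q-p≈2))

    module _ (a d f : ℕ) (a+d+f≡n : a ℕ.+ d ℕ.+ f ≡ n) (σd≈1 : σ d ≈ 1#) where
      private
        A D F : Carrier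
        A = fromℕ a
        D = fromℕ d
        F = fromℕ f
        N≈A+D+F : N ≈ A + D + F
        N≈A+D+F = trans (reflexive (≡.cong fromℕ (≡.sym a+d+f≡n))) (trans (fromℕ-+ (a ℕ.+ d) f) (+-congʳ
            (fromℕ-+ a d)))
        q≈ : p (a ℕ.+ d) ≈ N - fromℕ 2 * F
        q≈ = trans (+-congʳ (*-congˡ (fromℕ-+ a d))) (trans (+-congʳ (*-congˡ
            (trans (solve 3 (λ A D F → A :+ D := A :+ D :+ F :- F) refl A D F) (+-congʳ (sym N≈A+D+F)))))
          (solve 2 (λ N F → ♯ 2 :* (N :- F) :- N := N :- ♯ 2 :* F) refl N F))
        J : Carrier
        J = N * N + p a * p (a ℕ.+ d)
        J≈ : J ≈ fromℕ 2 * (N * (A + F) - fromℕ 2 * (A * F))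
        J≈ = trans (+-congˡ (*-congˡ q≈)) (solve 3 (λ N A F → N :* N :+ (♯ 2 :* A :- N) :* (N :- ♯ 2 :* F)
          := ♯ 2 :* (N :* (A :+ F) :- ♯ 2 :* (A :* F))) refl N A F)

      -- As P a P (a + d) ≤ 4 N⁴, it suffices that J ≥ 4 N. The hypotheses are read off from J - 4 N
      -- = 2 (a² + f² - 4 + (d - 2) (a + f - 2)).
      close-even : 2 ℕ.≤ d → 2 ℕ.≤ a ℕ.+ f → 4 ℕ.≤ a ℕ.* a ℕ.+ f ℕ.* f → Close (equatorial a) (equatorial (a ℕ.+ d))
      close-even 2≤d 2≤a+f 4≤a²+f² = close a (a ℕ.+ d) (PP[1+dot]-even a d σd≈1)
        (≤-trans (4PP≤16N⁴ a (a ℕ.+ d) (ℕ.≤-trans (ℕ.m≤m+n a d) a+d≤n) a+d≤n) (*-monoˡ-≤ (<⇒≤ 0<N²)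
          (≤-resp-≈ (solve 1 (λ N → ♯ 4 :* N :* (♯ 4 :* N) := ♯ 16 :* (N :* N)) refl N) refl
            (*-mono-≤ 0≤4N (≤-trans 0≤4N 4N≤J) 4N≤J 4N≤J))))
        where
        a+d≤n : a ℕ.+ d ℕ.≤ n
        a+d≤n = ≡.subst (a ℕ.+ d ℕ.≤_) a+d+f≡n (ℕ.m≤m+n (a ℕ.+ d) f)
        0≤4N : 0# ≤ fromℕ 4 * N
        0≤4N = 0≤* (0≤fromℕ 4) (<⇒≤ 0<N)
        2≤A+F : fromℕ 2 ≤ A + F
        2≤A+F = ≤-resp-≈ refl (fromℕ-+ a f) (fromℕ-mono-≤ 2≤a+f)
        4≤A²+F² : fromℕ 4 ≤ A * A + F * F
        4≤A²+F² = ≤-resp-≈ refl (trans (fromℕ-+ (a ℕ.* a) (f ℕ.* f)) (+-cong (×1-homo-* a a) (×1-homo-* f f)))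
            (fromℕ-mono-≤ 4≤a²+f²)
        4N≤J : fromℕ 4 * N ≤ J
        4N≤J = ≤-by (fromℕ 2 * (A * A + F * F - fromℕ 4 + (D - fromℕ 2) * (A + F - fromℕ 2)))
          (0≤* (0≤fromℕ 2) (0≤+ (≤⇒0≤- 4≤A²+F²) (0≤* (≤⇒0≤- (fromℕ-mono-≤ 2≤d)) (≤⇒0≤- 2≤A+F))))
          (trans (solve 3 (λ A D F → ♯ 2 :* (A :* A :+ F :* F :- ♯ 4 :+ (D :- ♯ 2) :* (A :+ F :- ♯ 2))
              := ♯ 2 :* ((A :+ D :+ F) :* (A :+ F) :- ♯ 2 :* (A :* F)) :- ♯ 4 :* (A :+ D :+ F)) refl A D F)
            (sym (+-cong (trans J≈ (*-congˡ (+-congʳ (*-congʳ N≈A+D+F)))) (-‿cong (*-congˡ N≈A+D+F)))))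

      -- Here J is only 2 N while P 0 = 2 N², so N² J² = 4 N⁴ stays below 4 P 0 P d, which is at
      -- least 8 N⁴.
      far-ends : a ≡ 0 → f ≡ 1 → Far (equatorial a) (equatorial (a ℕ.+ d))
      far-ends ≡.refl ≡.refl = far a (a ℕ.+ d) (PP[1+dot]-even a d σd≈1) (<-by
        (fromℕ 4 * (N * N * (N * N)) + fromℕ 8 * (N * N * (q * q)))
        (0<+ (*-positive (0<fromℕ-suc 3) (*-positive 0<N² 0<N²)) (0≤* (0≤fromℕ 8) (0≤* (<⇒≤ 0<N²) (0≤x² q))))
        (trans (solve 2 (λ N q → let J = ♯ 2 :* (N :* (♯ 0 :+ (♯ 1 :+ ♯ 0)) :- ♯ 2 :* (♯ 0 :* (♯ 1 :+ ♯ 0))) in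
            ♯ 4 :* (N :* N :* (N :* N)) :+ ♯ 8 :* (N :* N :* (q :* q)) :=
            ♯ 4 :* ((N :* N :+ (♯ 2 :* ♯ 0 :- N) :* (♯ 2 :* ♯ 0 :- N)) :* (N :* N :+ q :* q)) :- N :* N :*
                (J :* J)) refl N q)
          (+-congˡ (-‿cong (*-congˡ (sym (*-cong J≈ J≈)))))))
        where q = p (a ℕ.+ d)

  -- The spherical representation

  module SphericalRepresentation (k : ℕ) (1≤k : 1 ℕ.≤ k) where

    n : ℕ
    n = 2 ℕ.* k ℕ.+ 1

    n≡1+2k : n ≡ suc (2 ℕ.* k)
    n≡1+2k = ℕ.+-comm (2 ℕ.* k) 1

    3≤n : 3 ℕ.≤ n
    3≤n = ≡.subst (3 ℕ.≤_) (≡.sym n≡1+2k) (ℕ.s≤s (ℕ.*-monoʳ-≤ 2 1≤k))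

    open Centres n 3≤n

    even-complement : ∀ {a d f} → a ℕ.+ d ℕ.+ f ≡ n → ∀ e → d ≡ 2 ℕ.* e → ∀ h → ¬ a ℕ.+ f ≡ 2 ℕ.* h
    even-complement {a} {d} {f} a+d+f≡n e d≡2e h a+f≡2h = ℕ.even≢odd (h ℕ.+ e) k (≡.trans
      (≡.trans (ℕ.*-distribˡ-+ 2 h e) (≡.sym (≡.cong₂ ℕ._+_ a+f≡2h d≡2e)))
      (≡.trans (swap a d f) (≡.trans a+d+f≡n n≡1+2k)))
      where
      swap : ∀ a d f → a ℕ.+ f ℕ.+ d ≡ a ℕ.+ d ℕ.+ f
      swap = solve-∀

    -- a, o and g count the indices before, strictly between and after the two, so that adjacency in
    -- the cycle reads: o = 0, or a = g = 0.
    cycle-close : ∀ a o g → a ℕ.+ suc o ℕ.+ suc g ≡ n → ¬ o ≡ 0 → ¬ (a ≡ 0 × g ≡ 0) →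
      Close (equatorial a) (equatorial (a ℕ.+ suc o))
    cycle-close a zero    g _     o≢0 _  = ⊥-elim (o≢0 ≡.refl)
    cycle-close a (suc o) g total _   ¬ends = by-parity (parity d)
      where
      d = suc (suc o)
      2≤d : 2 ℕ.≤ d
      2≤d = ℕ.s≤s (ℕ.s≤s ℕ.z≤n)
      a+f : ∀ e → d ≡ 2 ℕ.* e → ∀ a g → a ℕ.+ d ℕ.+ suc g ≡ n → ¬ (a ≡ 0 × g ≡ 0) →
        2 ℕ.≤ a ℕ.+ suc g × 4 ℕ.≤ a ℕ.* a ℕ.+ suc g ℕ.* suc g
      a+f _ _    zero    zero    _     ¬ends = ⊥-elim (¬ends (≡.refl , ≡.refl))
      -- The pairs (a , f) = (0 , 2) and (1 , 1) have an even sum, which an even d and an odd n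
      -- exclude. Among the others only (0 , 1), the two ends, would violate a bound.
      a+f e d≡2e zero    (suc zero) total _ = ⊥-elim (even-complement {0} total e d≡2e 1 ≡.refl)
      a+f _ _    zero    (suc (suc g)) _ _ = ℕ.m≤m+n 2 _ , ℕ.*-mono-≤ (ℕ.m≤m+n 2 (suc g)) (ℕ.m≤m+n 2 (suc g))
      a+f e d≡2e (suc zero) zero total _ = ⊥-elim (even-complement {1} total e d≡2e 1 ≡.refl)
      a+f _ _    (suc zero) (suc g) _ _ = ℕ.m≤m+n 2 _ , ℕ.≤-trans (ℕ.*-mono-≤ (ℕ.m≤m+n 2 g) (ℕ.m≤m+n 2 g)) (ℕ.n≤1+n _)
      a+f _ _    (suc (suc a)) g _ _ = ℕ.m≤m+n 2 _ , ℕ.≤-trans (ℕ.*-mono-≤ (ℕ.m≤m+n 2 a) (ℕ.m≤m+n 2 a)) (ℕ.m≤m+n _ _)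
      by-parity : ∃[ e ] (d ≡ 2 ℕ.* e ⊎ d ≡ suc (2 ℕ.* e)) → Close (equatorial a) (equatorial (a ℕ.+ d))
      by-parity (e , inj₁ d≡2e) = let 2≤a+f , 4≤a²+f² = a+f e d≡2e a g total ¬ends in
        close-even a d (suc g) total (trans (reflexive (≡.cong σ d≡2e)) (σ-even e)) 2≤d 2≤a+f 4≤a²+f²
      by-parity (e , inj₂ d≡1+2e) = close-odd a d (≡.subst (a ℕ.+ d ℕ.≤_) total (ℕ.m≤m+n _ _))
        (trans (reflexive (≡.cong σ d≡1+2e)) (σ-odd e)) 2≤d

    cycle-far : ∀ a o g → a ℕ.+ suc o ℕ.+ suc g ≡ n → o ≡ 0 ⊎ (a ≡ 0 × g ≡ 0) →
      Far (equatorial a) (equatorial (a ℕ.+ suc o))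
    cycle-far a o g total (inj₁ ≡.refl) = far-successor a
    cycle-far a o g total (inj₂ (≡.refl , ≡.refl)) =
      far-ends 0 (suc o) 1 total (trans (reflexive (≡.cong σ 1+o≡2k)) (σ-even k)) ≡.refl ≡.refl
      where
      1+o≡2k : suc o ≡ 2 ℕ.* k
      1+o≡2k = ℕ.+-cancelʳ-≡ 1 (suc o) (2 ℕ.* k) total

    private
      Successor : ℕ → ℕ → Set
      Successor a b = suc a ≡ b ⊎ (suc a ≡ n × b ≡ 0)

      Adjacent : ℕ → ℕ → Set
      Adjacent a b = Successor a b ⊎ Successor b a

    adjacent⇒ : ∀ a o b g → suc a ℕ.+ o ≡ b → suc b ℕ.+ g ≡ n → Adjacent a b → o ≡ 0 ⊎ (a ≡ 0 × g ≡ 0)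
    adjacent⇒ a o b g 1+a+o≡b _ (inj₁ (inj₁ 1+a≡b)) =
      inj₁ (ℕ.+-cancelˡ-≡ (suc a) o 0 (≡.trans 1+a+o≡b (≡.trans (≡.sym 1+a≡b) (≡.sym (ℕ.+-identityʳ (suc a))))))
    adjacent⇒ a o .(suc a ℕ.+ o) g ≡.refl _ (inj₁ (inj₂ (_ , ())))
    adjacent⇒ a o .(suc a ℕ.+ o) g ≡.refl _ (inj₂ (inj₁ 2+a+o≡a)) =
      ⊥-elim (ℕ.<-irrefl (≡.sym 2+a+o≡a) (ℕ.s≤s (ℕ.≤-trans (ℕ.m≤m+n a o) (ℕ.n≤1+n _))))
    adjacent⇒ a o b g _ 1+b+g≡n (inj₂ (inj₂ (1+b≡n , a≡0))) =
      inj₂ (a≡0 , ℕ.+-cancelˡ-≡ (suc b) g 0 (≡.trans 1+b+g≡n (≡.trans (≡.sym 1+b≡n) (≡.sym (ℕ.+-identityʳ (suc b))))))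

    ⇒adjacent : ∀ a o b g → suc a ℕ.+ o ≡ b → suc b ℕ.+ g ≡ n → o ≡ 0 ⊎ (a ≡ 0 × g ≡ 0) → Adjacent a b
    ⇒adjacent a o b g 1+a+o≡b _ (inj₁ ≡.refl) = inj₁ (inj₁ (≡.trans (≡.sym (ℕ.+-identityʳ (suc a))) 1+a+o≡b))
    ⇒adjacent a o b g _ 1+b+g≡n (inj₂ (a≡0 , ≡.refl)) =
      inj₂ (inj₂ (≡.trans (≡.sym (ℕ.+-identityʳ (suc b))) 1+b+g≡n , a≡0))

    -- The proposition E is a parameter so that adjacency of natural numbers, in the cycle and in
    -- the disjoint union can be exchanged by `separated-map`.
    Separated : Set → Vec³ → Vec³ → Set
    Separated E v w = (E → Far v w) × (¬ E → Close v w)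

    separated-< : ∀ a b → a ℕ.< b → b ℕ.< n → Separated (Adjacent a b) (equatorial a) (equatorial b)
    separated-< a b a<b b<n =
      (λ adjacent → ≡.subst (Far (equatorial a) ∘ equatorial) b≡ (cycle-far a o g total
          (adjacent⇒ a o b g 1+a+o≡b 1+b+g≡n adjacent))) ,
      (λ ¬adjacent → ≡.subst (Close (equatorial a) ∘ equatorial) b≡ (cycle-close a o g total
        (¬adjacent ∘ ⇒adjacent a o b g 1+a+o≡b 1+b+g≡n ∘ inj₁)
            (¬adjacent ∘ ⇒adjacent a o b g 1+a+o≡b 1+b+g≡n ∘ inj₂)))
      where
      o = proj₁ (ℕ.m≤n⇒∃[o]m+o≡n a<b)
      1+a+o≡b = proj₂ (ℕ.m≤n⇒∃[o]m+o≡n a<b)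
      g = proj₁ (ℕ.m≤n⇒∃[o]m+o≡n b<n)
      1+b+g≡n = proj₂ (ℕ.m≤n⇒∃[o]m+o≡n b<n)
      b≡ : a ℕ.+ suc o ≡ b
      b≡ = ≡.trans (ℕ.+-suc a o) 1+a+o≡b
      total : a ℕ.+ suc o ℕ.+ suc g ≡ n
      total = ≡.trans (≡.cong (ℕ._+ suc g) b≡) (≡.trans (ℕ.+-suc b g) 1+b+g≡n)

    separated-sym : ∀ {E F} v w → (E → F) → (F → E) → Separated E v w → Separated F w v
    separated-sym v w E→F F→E (far , close) =
      (λ f → <-resp₂-≈ (+-congˡ (dot-comm v w)) refl (far (F→E f))) ,
      (λ ¬f → ≤-resp-≈ refl (+-congˡ (dot-comm v w)) (close (¬f ∘ E→F)))

    separated-map : ∀ {E F} v w → (E → F) → (F → E) → Separated E v w → Separated F v w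
    separated-map v w E→F F→E (far , close) = far ∘ F→E , close ∘ (_∘ E→F)

    separated-cycle : ∀ (x y : Fin n) → x ≢ y → Separated (Graph._~_ (C n) x y) (equatorial (toℕ x)) (equatorial
        (toℕ y))
    separated-cycle x y x≢y with ℕ.<-cmp (toℕ x) (toℕ y)
    ... | tri< x<y _ _ = separated-map (equatorial (toℕ x)) (equatorial (toℕ y)) (x≢y ,_) proj₂ (separated-<
        (toℕ x) (toℕ y) x<y (Fin.toℕ<n y))
    ... | tri≈ _ x≡y _ = ⊥-elim (x≢y (Fin.toℕ-injective x≡y))
    ... | tri> _ _ y<x = separated-sym (equatorial (toℕ y)) (equatorial (toℕ x))
        (λ adjacent → x≢y , Sum.swap adjacent) (Sum.swap ∘ proj₂)
            (separated-< (toℕ y) (toℕ x) y<x (Fin.toℕ<n x))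

    north south : Vec³
    north 0F = 0#
    north 1F = 0#
    north 2F = 1#
    south 0F = 0#
    south 1F = 0#
    south 2F = - 1#

    north-south-far : Far north south
    north-south-far = <-respˡ-≈ (solve 0 (♯ 0 := ♯ 1 :+ (♯ 0 :* ♯ 0 :+ (♯ 0 :* ♯ 0 :+ (♯ 1 :* :- ♯ 1 :+ ♯ 0)))) refl)
      (*-positive (0<fromℕ-suc 1) (*-positive 0<c 0<c))

    orthogonal⇒close : ∀ {v w} → v ∙ w ≈ 0# → Close v w
    orthogonal⇒close v∙w≈0 = ≤-resp-≈ refl (sym (trans (+-congˡ v∙w≈0) (+-identityʳ 1#))) 2c²≤1

    north-close : ∀ a → Close north (equatorial a)
    north-close a = orthogonal⇒close {north} {equatorial a} (solve 2
        (λ x y → ♯ 0 :* x :+ (♯ 0 :* y :+ (♯ 1 :* ♯ 0 :+ ♯ 0)) := ♯ 0)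
      refl (equatorial a 0F) (equatorial a 1F))

    south-close : ∀ a → Close south (equatorial a)
    south-close a = orthogonal⇒close {south} {equatorial a} (solve 2
        (λ x y → ♯ 0 :* x :+ (♯ 0 :* y :+ (:- ♯ 1 :* ♯ 0 :+ ♯ 0)) := ♯ 0)
      refl (equatorial a 0F) (equatorial a 1F))

    H : Graph
    H = K 2 ⊕ C n

    centres : Fin (Graph.order H) → 𝕊² ℝ
    centres 0F = north , solve 0 (♯ 0 :* ♯ 0 :+ (♯ 0 :* ♯ 0 :+ (♯ 1 :* ♯ 1 :+ ♯ 0)) := ♯ 1) refl
    centres 1F = south , solve 0 (♯ 0 :* ♯ 0 :+ (♯ 0 :* ♯ 0 :+ (:- ♯ 1 :* :- ♯ 1 :+ ♯ 0)) := ♯ 1) refl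
    centres (Fin.suc (Fin.suc x)) = centre (toℕ x)

    separated : ∀ i j → i ≢ j → Separated (Graph._~_ H i j) (proj₁ (centres i)) (proj₁ (centres j))
    separated 0F 0F i≢j = ⊥-elim (i≢j ≡.refl)
    separated 1F 1F i≢j = ⊥-elim (i≢j ≡.refl)
    separated 0F 1F _ = (λ _ → north-south-far) , λ i≁j → ⊥-elim (i≁j (Pointwise.inj₁ (λ ())))
    separated 1F 0F _ = (λ _ → <-resp₂-≈ (+-congˡ (dot-comm north south))
        refl north-south-far) , λ i≁j → ⊥-elim (i≁j (Pointwise.inj₁ (λ ())))
    separated 0F (Fin.suc (Fin.suc y)) _ = (λ ()) , λ _ → north-close (toℕ y)
    separated 1F (Fin.suc (Fin.suc y)) _ = (λ ()) , λ _ → south-close (toℕ y)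
    separated (Fin.suc (Fin.suc x)) 0F _ = (λ ()) , λ _ → ≤-resp-≈
        refl (+-congˡ (dot-comm north (equatorial (toℕ x)))) (north-close (toℕ x))
    separated (Fin.suc (Fin.suc x)) 1F _ = (λ ()) , λ _ → ≤-resp-≈
        refl (+-congˡ (dot-comm south (equatorial (toℕ x)))) (south-close (toℕ x))
    separated (Fin.suc (Fin.suc x)) (Fin.suc (Fin.suc y)) i≢j = separated-map (equatorial (toℕ x)) (equatorial
        (toℕ y)) Pointwise.inj₂ Pointwise.drop-inj₂
      (separated-cycle x y (i≢j ∘ ≡.cong (λ z → Fin.suc (Fin.suc z))))

    isSphericalUniformDiskGraph : IsSphericalUniformDiskGraph ℝ (∁ H)
    isSphericalUniformDiskGraph = π , π-isPi , radius 0<c c<1 , 0<radius 0<c c<1 , radius<π 0<c c<1 , centres , λ i j i≢j →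
      mk⇔ (λ (_ , i≁j) → close⇒disks-meet 0<c c<1 (centres i) (centres j) (proj₂ (separated i j i≢j) i≁j))
          (λ meet → i≢j , λ i~j → disks-meet⇒close 0<c c<1 (centres i) (centres j) meet (proj₁
              (separated i j i≢j) i~j))

  -- Unit disk graphs

  Point : Set
  Point = Vector Carrier 2

  distance² : Point → Point → Carrier
  distance² v w = dot ℝ (λ i → v i - w i) (λ i → v i - w i)

  distance²-sym : ∀ v w → distance² v w ≈ distance² w v
  distance²-sym v w = +-cong (swap (v 0F) (w 0F)) (+-congʳ (swap (v 1F) (w 1F)))
    where
    swap : ∀ x y → (x - y) * (x - y) ≈ (y - x) * (y - x)
    swap = solve 2 (λ x y → (x :- y) :* (x :- y) := (y :- x) :* (y :- x)) refl

  module _ {r : Carrier} where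

    -- ∣v - w∣² + ∣2u - v - w∣² = 2 ∣u - v∣² + 2 ∣u - w∣²
    closedDisks-meet⇒ : ∀ v w → closedDisk ℝ r v ≬ closedDisk ℝ r w → distance² v w ≤ fromℕ 4 * (r * r)
    closedDisks-meet⇒ v w (u , u∈v , u∈w) = begin
      distance² v w
        ≤⟨ +-mono-≤ (parallelogram (u 0F) (v 0F) (w 0F)) (+-mono-≤ (parallelogram (u 1F) (v 1F) (w 1F)) ≤-refl) ⟩
      fromℕ 2 * (square′ u v 0F + square′ u w 0F) + (fromℕ 2 * (square′ u v 1F + square′ u w 1F) + 0#)
        ≈⟨ solve 4 (λ a b c d → ♯ 2 :* (a :+ c) :+ (♯ 2 :* (b :+ d) :+ ♯ 0)
            := ♯ 2 :* (a :+ (b :+ ♯ 0) :+ (c :+ (d :+ ♯ 0)))) refl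
             (square′ u v 0F) (square′ u v 1F) (square′ u w 0F) (square′ u w 1F) ⟩
      fromℕ 2 * (distance² u v + distance² u w)
        ≤⟨ *-monoˡ-≤ (0≤fromℕ 2) (+-mono-≤ u∈v u∈w) ⟩
      fromℕ 2 * (r * r + r * r)
        ≈⟨ solve 1 (λ r → ♯ 2 :* (r :* r :+ r :* r) := ♯ 4 :* (r :* r)) refl r ⟩
      fromℕ 4 * (r * r) ∎
      where
      open ≤-Reasoning
      square′ : Point → Point → Fin 2 → Carrier
      square′ v w i = (v i - w i) * (v i - w i)
      parallelogram : ∀ u v w → (v - w) * (v - w) ≤ fromℕ 2 * ((u - v) * (u - v) + (u - w) * (u - w))
      parallelogram u v w = ≤-by _ (0≤x² (u + u - v - w))
        (solve 3 (λ u v w → (u :+ u :- v :- w) :* (u :+ u :- v :- w) :=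
          ♯ 2 :* ((u :- v) :* (u :- v) :+ (u :- w) :* (u :- w)) :- (v :- w) :* (v :- w)) refl u v w)

    ⇒closedDisks-meet : ∀ v w → distance² v w ≤ fromℕ 4 * (r * r) → closedDisk ℝ r v ≬ closedDisk ℝ r w
    ⇒closedDisks-meet v w d²≤4r² = u , near v w u-v d²≤4r² , near w v u-w (≤-resp-≈ (distance²-sym v w) refl d²≤4r²)
      where
      u : Point
      u i = half * (v i + w i)
      u-v : ∀ i → u i - v i ≈ half * (w i - v i)
      u-v i = trans (+-congˡ (-‿cong (sym (half*x+half*x≈x (v i)))))
        (solve 3 (λ h v w → h :* (v :+ w) :- (h :* v :+ h :* v) := h :* (w :- v)) refl half (v i) (w i))
      u-w : ∀ i → u i - w i ≈ half * (v i - w i)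
      u-w i = trans (+-congˡ (-‿cong (sym (half*x+half*x≈x (w i)))))
        (solve 3 (λ h v w → h :* (v :+ w) :- (h :* w :+ h :* w) := h :* (v :- w)) refl half (v i) (w i))
      near : ∀ v w → (∀ i → u i - v i ≈ half * (w i - v i)) → distance² v w ≤ fromℕ 4 * (r * r) → closedDisk ℝ r v u
      near v w u-v d²≤4r² = *-cancelˡ-≤ (0<fromℕ-suc 3) (begin
        fromℕ 4 * distance² u v   ≈⟨ *-congˡ (+-cong (*-cong (u-v 0F) (u-v 0F)) (+-congʳ (*-cong (u-v 1F)
            (u-v 1F)))) ⟩
        _                         ≈⟨ solve 3 (λ h x y → ♯ 4 :* (h :* x :* (h :* x) :+ (h :* y :* (h :* y) :+ ♯ 0)) :=
                                       (h :+ h) :* (h :+ h) :* (x :* x :+ (y :* y :+ ♯ 0)))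
                                           refl half (w 0F - v 0F) (w 1F - v 1F) ⟩
        (half + half) * (half + half) * distance² w v ≈⟨ *-congʳ (*-cong half+half≈1 half+half≈1) ⟩
        1# * 1# * distance² w v   ≈⟨ trans (*-congʳ (*-identityˡ 1#)) (*-identityˡ _) ⟩
        distance² w v             ≈⟨ distance²-sym w v ⟩
        distance² v w             ≤⟨ d²≤4r² ⟩
        fromℕ 4 * (r * r)         ∎)
        where open ≤-Reasoning

  -- (X , Y) and (X′ , Y′) stand for the coordinates of two points along and across
  -- ab, measured from a and scaled by ∣ab∣ = √N.
  module _ {N R : Carrier} (0≤R : 0# ≤ R) (R<N : R < N) where

    private
      0<N : 0# < N
      0<N = ≤-<-trans 0≤R R<N

      NR<NN : N * R < N * N
      NR<NN = *-monoˡ-< 0<N R<N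

    -- A point nearer to b than ∣ab∣ cannot project onto the line beyond a, nor one that near to a
    -- beyond b.
    between : ∀ {X Y} → X * X + Y * Y ≤ N * R → (X - N) * (X - N) + Y * Y ≤ N * R → 0# ≤ X × 0# ≤ N - X
    between {X} {Y} near-a near-b = 0≤X , 0≤N-X
      where
      square-part : ∀ {z} → z * z + Y * Y ≤ N * R → z * z < N * N
      square-part {z} near = ≤-<-trans (≤-by _ (0≤x² Y) (solve 2 (λ z y → y := z :+ y :- z)
          refl (z * z) (Y * Y))) (≤-<-trans near NR<NN)
      0≤X : 0# ≤ X
      0≤X X<0 = <-asym (square-part near-b) (<-by (- X * (N + N - X))
        (*-positive (x<0⇒0<-x X<0) (0<+ (0<+ 0<N (<⇒≤ 0<N)) (<⇒≤ (x<0⇒0<-x X<0))))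
        (solve 2 (λ N X → :- X :* (N :+ N :- X) := (X :- N) :* (X :- N) :- N :* N) refl N X))
      0≤N-X : 0# ≤ N - X
      0≤N-X N-X<0 = <-asym (square-part near-a) (<-by (- (N - X) * (N + X))
        (*-positive (x<0⇒0<-x N-X<0) (0<+ 0<N 0≤X))
        (solve 2 (λ N X → :- (N :- X) :* (N :+ X) := X :* X :- N :* N) refl N X))

    module _ {X Y X′ Y′ : Carrier}
      (near-a : X * X + Y * Y ≤ N * R) (near-b : (X - N) * (X - N) + Y * Y ≤ N * R)
      (near-a′ : X′ * X′ + Y′ * Y′ ≤ N * R) (near-b′ : (X′ - N) * (X′ - N) + Y′ * Y′ ≤ N * R)
      (apart : N * R < (X′ - X) * (X′ - X) + (Y′ - Y) * (Y′ - Y)) where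

      -- With T = X + 2 (X′ - X), X T < 0 and (N - X) (N - T) < 0, whence T < 0 and N < T.
      not-higher : ¬ 0# ≤ Y * (Y′ - Y)
      not-higher 0≤YV = T≮0 λ T<0 → N-T≮0 λ N-T<0 →
        <-asym 0<N (<-respˡ-≈ (solve 2 (λ N T → ♯ 0 :- (:- T :+ :- (N :- T)) := N) refl N T)
          (0<-⇒< (<-respʳ-≈ (solve 1 (λ s → s := ♯ 0 :- (♯ 0 :- s)) refl (- T - (N - T)))
            (0<+ (x<0⇒0<-x T<0) (<⇒≤ (x<0⇒0<-x N-T<0))))))
        where
        U = X′ - X
        T = X + fromℕ 2 * U
        -- With V = Y′ - Y, subtracting `near` from `apart` leaves z (z + 2 U) < - (2 Y V + Y²) ≤ 0.
        -- It is used at z = X and at z = X - N.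
        excess : ∀ z z′ → z′ - z ≈ U → z′ * z′ + Y′ * Y′ ≤ N * R → z * (z + fromℕ 2 * U) < 0#
        excess z z′ z′-z≈U near = 0<-⇒< (<-respʳ-≈ (trans
            (+-congˡ (+-congʳ (+-congˡ (-‿cong (+-congʳ (*-cong z′≈ z′≈))))))
            (solve 5 (λ z U Y Y′ NR → U :* U :+ (Y′ :- Y) :* (Y′ :- Y) :- NR :+ (NR :- ((z :+ U) :*
                (z :+ U) :+ Y′ :* Y′) :+ (♯ 2 :* (Y :* (Y′ :- Y)) :+ Y :* Y))
              := ♯ 0 :- z :* (z :+ ♯ 2 :* U)) refl z U Y Y′ (N * R)))
          (0<+ (<⇒0<- apart) (0≤+ (≤⇒0≤- near) (0≤+ (0≤* (0≤fromℕ 2) 0≤YV) (0≤x² Y)))))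
          where
          z′≈ : z′ ≈ z + U
          z′≈ = trans (solve 2 (λ z z′ → z′ := z :+ (z′ :- z)) refl z z′) (+-congˡ z′-z≈U)
        T≮0 : ¬ 0# ≤ T
        T≮0 0≤T = 0≤* (proj₁ (between near-a near-b)) 0≤T (excess X X′ refl near-a′)
        N-T≮0 : ¬ 0# ≤ N - T
        N-T≮0 0≤N-T = 0≤* (proj₂ (between near-a near-b)) 0≤N-T (<-respˡ-≈
          (solve 3 (λ N X U → (X :- N) :* (X :- N :+ ♯ 2 :* U) := (N :- X) :* (N :- (X :+ ♯ 2 :* U))) refl N X U)
          (excess (X - N) (X′ - N) (solve 3 (λ N X X′ → X′ :- N :- (X :- N) := X′ :- X) refl N X X′) near-b′))

    -- Of two points on the same side, one would be at least as far from the line as the other,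
    -- against `not-higher`. Which one cannot be decided, so both instances are used at once: Y (Y′
    -- - Y) and Y′ (Y - Y′) are negative, and their product is - Y Y′ (Y′ - Y)².
    opposite-sides : ∀ {X Y X′ Y′ : Carrier} →
      X * X + Y * Y ≤ N * R → (X - N) * (X - N) + Y * Y ≤ N * R →
      X′ * X′ + Y′ * Y′ ≤ N * R → (X′ - N) * (X′ - N) + Y′ * Y′ ≤ N * R →
      N * R < (X′ - X) * (X′ - X) + (Y′ - Y) * (Y′ - Y) → ¬ 0# ≤ Y * Y′
    opposite-sides {X} {Y} {X′} {Y′} near-a near-b near-a′ near-b′ apart 0≤YY′ =
      not-higher near-a near-b near-a′ near-b′ apart λ z<0 →
      not-higher near-a′ near-b′ near-a near-b apart′ λ z′<0 →
      0≤* 0≤YY′ (0≤x² (Y′ - Y)) (0<-⇒< (<-respʳ-≈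
        (solve 2 (λ Y Y′ → :- (Y :* (Y′ :- Y)) :* :- (Y′ :* (Y :- Y′))
            := ♯ 0 :- Y :* Y′ :* ((Y′ :- Y) :* (Y′ :- Y))) refl Y Y′)
        (*-positive (x<0⇒0<-x z<0) (x<0⇒0<-x z′<0))))
      where
      apart′ : N * R < (X - X′) * (X - X′) + (Y - Y′) * (Y - Y′)
      apart′ = <-respʳ-≈ (solve 4 (λ X Y X′ Y′ → (X′ :- X) :* (X′ :- X) :+ (Y′ :- Y) :* (Y′ :- Y)
        := (X :- X′) :* (X :- X′) :+ (Y :- Y′) :* (Y :- Y′)) refl X Y X′ Y′) apart

  -- Coordinates relative to a line

  module _ (a b : Point) where
    private
      n₀ n₁ N : Carrier
      n₀ = b 0F - a 0F
      n₁ = b 1F - a 1F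
      N = distance² b a

    -- Normalising b - a would take a square root; instead the factor ∣ab∣ is kept, and squared
    -- distances acquire the factor N.
    along across : Point → Carrier
    along  q = n₀ * (q 0F - a 0F) + n₁ * (q 1F - a 1F)
    across q = n₀ * (q 1F - a 1F) - n₁ * (q 0F - a 0F)

    private
      lagrange : ∀ x y → N * (x * x + (y * y + 0#)) ≈
        (n₀ * x + n₁ * y) * (n₀ * x + n₁ * y) + (n₀ * y - n₁ * x) * (n₀ * y - n₁ * x)
      lagrange = solve 4 (λ n₀ n₁ x y → (n₀ :* n₀ :+ (n₁ :* n₁ :+ ♯ 0)) :* (x :* x :+ (y :* y :+ ♯ 0)) :=
        (n₀ :* x :+ n₁ :* y) :* (n₀ :* x :+ n₁ :* y) :+ (n₀ :* y :- n₁ :* x) :* (n₀ :* y :- n₁ :* x)) refl n₀ n₁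

      difference-square : ∀ p q → N * distance² p q ≈
        (along p - along q) * (along p - along q) + (across p - across q) * (across p - across q)
      difference-square p q = trans (lagrange (p 0F - q 0F) (p 1F - q 1F)) (+-cong (*-cong along≈ along≈)
          (*-cong across≈ across≈))
        where
        split : ∀ n p q a → n * (p - q) ≈ n * (p - a) - n * (q - a)
        split = solve 4 (λ n p q a → n :* (p :- q) := n :* (p :- a) :- n :* (q :- a)) refl
        along≈ : n₀ * (p 0F - q 0F) + n₁ * (p 1F - q 1F) ≈ along p - along q
        along≈ = trans (+-cong (split n₀ (p 0F) (q 0F) (a 0F)) (split n₁ (p 1F) (q 1F) (a 1F)))
          (solve 4 (λ s t u v → (s :- t) :+ (u :- v) := s :+ u :- (t :+ v)) refl _ _ _ _)
        across≈ : n₀ * (p 1F - q 1F) - n₁ * (p 0F - q 0F) ≈ across p - across q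
        across≈ = trans (+-cong (split n₀ (p 1F) (q 1F) (a 1F)) (-‿cong (split n₁ (p 0F) (q 0F) (a 0F))))
          (solve 4 (λ s t u v → (s :- t) :- (u :- v) := s :- u :- (t :- v)) refl _ _ _ _)

      along-b : along b ≈ N
      along-b = +-congˡ (sym (+-identityʳ _))

      across-b : across b ≈ 0#
      across-b = solve 2 (λ n₀ n₁ → n₀ :* n₁ :- n₁ :* n₀ := ♯ 0) refl n₀ n₁

    separated-across : ∀ {R} → 0# ≤ R → R < distance² a b → ∀ p q →
      distance² p a ≤ R → distance² p b ≤ R → distance² q a ≤ R → distance² q b ≤ R → R < distance² p q →
      ¬ 0# ≤ across p * across q
    separated-across {R} 0≤R R<ab p q pa pb qa qb R<pq = opposite-sides 0≤R R<N
      (near-a p pa) (near-b p pb) (near-a q qa) (near-b q qb)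
      (<-respʳ-≈ (trans (*-congˡ (distance²-sym p q)) (difference-square q p)) (*-monoˡ-< 0<N R<pq))
      where
      R<N : R < N
      R<N = <-respʳ-≈ (distance²-sym a b) R<ab
      0<N : 0# < N
      0<N = ≤-<-trans 0≤R R<N
      near-a : ∀ q → distance² q a ≤ R → along q * along q + across q * across q ≤ N * R
      near-a q qa = ≤-resp-≈ (lagrange (q 0F - a 0F) (q 1F - a 1F)) refl (*-monoˡ-≤ (<⇒≤ 0<N) qa)
      near-b : ∀ q → distance² q b ≤ R → (along q - N) * (along q - N) + across q * across q ≤ N * R
      near-b q qb = ≤-resp-≈ (trans (difference-square q b) (+-cong (*-cong along≈ along≈)
          (*-cong across≈ across≈))) refl
        (*-monoˡ-≤ (<⇒≤ 0<N) qb)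
        where
        along≈ : along q - along b ≈ along q - N
        along≈ = +-congˡ (-‿cong along-b)
        across≈ : across q - across b ≈ across q
        across≈ = trans (+-congˡ (-‿cong across-b)) (trans (+-congˡ -0#≈0#) (+-identityʳ _))

  -- Signs around an odd cycle

  negative*negative : x * y < 0# → y * z < 0# → 0# < x * z
  negative*negative {x} {y} {z} xy<0 yz<0 = 0<-cancel-* (0≤x² y) (<-respʳ-≈
    (solve 3 (λ x y z → :- (x :* y) :* :- (y :* z) := y :* y :* (x :* z)) refl x y z)
    (*-positive (x<0⇒0<-x xy<0) (x<0⇒0<-x yz<0)))

  positive*negative : 0# < x * y → y * z < 0# → x * z < 0#
  positive*negative {x} {y} {z} 0<xy yz<0 = 0<-⇒< (<-respʳ-≈ (solve 2 (λ x z → x :* :- z := ♯ 0 :- x :* z) refl x z)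
    (negative*negative {x} { - y} { - z}
      (0<-⇒< (<-respʳ-≈ (solve 2 (λ x y → x :* y := ♯ 0 :- x :* :- y) refl x y) 0<xy))
      (<-respˡ-≈ (solve 2 (λ y z → y :* z := :- y :* :- z) refl y z) yz<0)))

  -- Unlike 2 * e + 1, this reduces to two successors at each step, which the induction in
  -- `odd-opposite` follows.
  oddNumber : ℕ → ℕ
  oddNumber zero    = 1
  oddNumber (suc e) = 2 ℕ.+ oddNumber e

  oddNumber≡ : ∀ e → oddNumber e ≡ suc (2 ℕ.* e)
  oddNumber≡ zero    = ≡.refl
  oddNumber≡ (suc e) = ≡.trans (≡.cong (2 ℕ.+_) (oddNumber≡ e)) (≡.cong suc (≡.sym (ℕ.*-suc 2 e)))

  odd-length : ∀ {k} → 1 ℕ.≤ k → ∃[ e ] 2 ℕ.+ oddNumber e ≡ 2 ℕ.* k ℕ.+ 1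
  odd-length {suc e} _ = e , ≡.trans (oddNumber≡ (suc e)) (ℕ.+-comm 1 (2 ℕ.* suc e))

  module _ {n : ℕ} (s : Fin n → Carrier)
    (alternates : ∀ x y → CyclicSuccessor x y → ¬ ¬ (s x * s y < 0#)) where

    private
      at : ∀ m → m ℕ.< n → Carrier
      at m m<n = s (Fin.fromℕ< m<n)

      alternates-at : ∀ m m<n 1+m<n → ¬ ¬ (at m m<n * at (suc m) 1+m<n < 0#)
      alternates-at m m<n 1+m<n = alternates _ _
        (inj₁ (≡.trans (≡.cong suc (Fin.toℕ-fromℕ< m<n)) (≡.sym (Fin.toℕ-fromℕ< 1+m<n))))

      odd-opposite : ∀ e 0<n e<n → ¬ ¬ (at 0 0<n * at (oddNumber e) e<n < 0#)
      odd-opposite zero    0<n e<n = alternates-at 0 0<n e<n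
      odd-opposite (suc e) 0<n e<n k =
        odd-opposite e 0<n -2+e<n λ opposite →
        alternates-at (oddNumber e) -2+e<n 1+e<n λ step →
        alternates-at (suc (oddNumber e)) 1+e<n e<n λ step′ →
        k (positive*negative (negative*negative opposite step) step′)
        where
        1+e<n : suc (oddNumber e) ℕ.< n
        1+e<n = ℕ.<-trans (ℕ.n<1+n _) e<n
        -2+e<n : oddNumber e ℕ.< n
        -2+e<n = ℕ.<-trans (ℕ.n<1+n _) 1+e<n

    -- Index `oddNumber e` has the sign opposite to index 0, so the last index, one further, has the
    -- sign of index 0 again; but the cycle makes these two neighbours.
    odd-cycle-cannot-alternate : ∀ e → 2 ℕ.+ oddNumber e ≡ n → ⊥
    odd-cycle-cannot-alternate e ≡.refl =
      odd-opposite e 0<n e<n λ opposite →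
      alternates-at (oddNumber e) e<n 1+e<n λ step →
      alternates _ (Fin.fromℕ< 0<n) (inj₂ (≡.cong suc (Fin.toℕ-fromℕ< 1+e<n) , ≡.refl)) λ last →
      <-asym last (<-respʳ-≈ (*-comm _ _) (negative*negative opposite step))
      where
      1+e<n : suc (oddNumber e) ℕ.< n
      1+e<n = ℕ.n<1+n _
      e<n : oddNumber e ℕ.< n
      e<n = ℕ.<-trans (ℕ.n<1+n _) 1+e<n
      0<n : 0 ℕ.< n
      0<n = ℕ.s≤s ℕ.z≤n

  -- No representation by unit disks in the plane

  module _ (e : ℕ) {n : ℕ} (2+e≡n : 2 ℕ.+ oddNumber e ≡ n) where

    not-isUnitDiskGraph : ¬ IsUnitDiskGraph ℝ (∁ (K 2 ⊕ C n))
    not-isUnitDiskGraph (r , _ , centre , intersection) =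
      odd-cycle-cannot-alternate (across a b ∘ v) alternates e 2+e≡n
      where
      H = K 2 ⊕ C n
      R : Carrier
      R = fromℕ 4 * (r * r)
      a b : Point
      a = centre 0F
      b = centre 1F
      v : Fin n → Point
      v x = centre (Fin.suc (Fin.suc x))
      nonadjacent⇒near : ∀ i j → i ≢ j → ¬ Graph._~_ H i j → distance² (centre i) (centre j) ≤ R
      nonadjacent⇒near i j i≢j i≁j = closedDisks-meet⇒ (centre i) (centre j) (Equivalence.to
          (intersection i j i≢j) (i≢j , i≁j))
      -- Disjointness of the disks only refutes a `≤`, which is itself a negated `<`; hence the
      -- double negation.
      adjacent⇒apart : ∀ i j → i ≢ j → Graph._~_ H i j → ¬ ¬ (R < distance² (centre i) (centre j))
      adjacent⇒apart i j i≢j i~j near =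
        proj₂ (Equivalence.from (intersection i j i≢j) (⇒closedDisks-meet (centre i) (centre j) near)) i~j
      near-a : ∀ x → distance² (v x) a ≤ R
      near-a x = nonadjacent⇒near (Fin.suc (Fin.suc x)) 0F (λ ()) (λ ())
      near-b : ∀ x → distance² (v x) b ≤ R
      near-b x = nonadjacent⇒near (Fin.suc (Fin.suc x)) 1F (λ ()) (λ ())
      2≤n : 2 ℕ.≤ n
      2≤n = ≡.subst (2 ℕ.≤_) 2+e≡n (ℕ.m≤m+n 2 (oddNumber e))
      successor-irreflexive : ∀ m l → 2 ℕ.≤ n → m ≡ l → ¬ (suc m ≡ l ⊎ (suc m ≡ n × l ≡ 0))
      successor-irreflexive m .m _ ≡.refl (inj₁ 1+m≡m) = ℕ.1+n≢n 1+m≡m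
      successor-irreflexive .0 .0 2≤n ≡.refl (inj₂ (1≡n , ≡.refl)) = ℕ.<-irrefl 1≡n 2≤n
      alternates : ∀ x y → CyclicSuccessor x y → ¬ ¬ (across a b (v x) * across a b (v y) < 0#)
      -- `same-side` refutes a negative product, and this is by definition the `0# ≤` that
      -- `separated-across` refutes.
      alternates x y successor same-side =
        adjacent⇒apart 0F 1F (λ ()) (Pointwise.inj₁ (λ ())) λ R<ab →
        adjacent⇒apart (Fin.suc (Fin.suc x)) (Fin.suc (Fin.suc y)) (x≢y ∘ Fin.suc-injective ∘ Fin.suc-injective)
          (Pointwise.inj₂ (x≢y , inj₁ successor)) λ R<xy →
        separated-across a b (0≤* (0≤fromℕ 4) (0≤x² r)) R<ab (v x) (v y) (near-a x) (near-b x) (near-a y)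
            (near-b y) R<xy same-side
        where
        x≢y : x ≢ y
        x≢y ≡.refl = successor-irreflexive (toℕ x) (toℕ x) 2≤n ≡.refl successor

open import Data.Nat.Base using (ℕ; NonZero; _+_; _*_)

proposition3p14 : (ℝ : RealNumbers) (k : ℕ) .{{_ : NonZero k}} →
    IsSphericalUniformDiskGraph ℝ (∁ (K 2 ⊕ C (2 * k + 1))) × ¬ IsUnitDiskGraph ℝ (∁ (K 2 ⊕ C (2 * k + 1)))
proposition3p14 ℝ k =
  SphericalRepresentation.isSphericalUniformDiskGraph k 1≤k ,
  not-isUnitDiskGraph (proj₁ (odd-length 1≤k)) (proj₂ (odd-length 1≤k))
  where
  open Proof ℝ
  1≤k : 1 ℕ.≤ k
  1≤k = ℕ.>-nonZero⁻¹ k
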